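{- For every $n\ge 2$ and every orientation $\bar G$ of the type $B_n$ Coxeter diagram, the type $B$ Cambrian lattice $C(\bar G)$ is trim. Equivalently, the set $\mathcal B$ of signed permutations in $B_n$ avoiding the patterns $\bar 231$ and $31\underline 2$, ordered by weak order, is a trim lattice.
   Context: $B_n$ is the group of signed permutations: bijections $\pi$ of $\{ -n,\dots,-1,1,\dots,n\}$ with $\pi(-i)=-\pi(i)$, written in one-line notation $\pi_{ -n}\cdots\pi_{ -1}\pi_1\cdots\pi_n$ with $\pi_i=\pi(i)$. The inversion set $I(\pi)$ is a set of positive roots: for $0<i<j$, $e_j-e_i\in I(\pi)$ iff $j$ precedes $i$ in the one-line notation; $e_i\in I(\pi)$ iff $i$ precedes $-i$; $e_j+e_i\in I(\pi)$ (for $i\neq j$) iff $i$ precedes $-j$. Weak order: $\pi\le\sigma$ iff $I(\pi)\subseteq I(\sigma)$; it is a lattice. The Coxeter diagram is a path $s_0,s_1,\dots,s_{n-1}$; an orientation $\bar G$ chooses for each $1\le i\le n-1$ either $s_{i-1}\to s_i$ or $s_{i-1}\leftarrow s_i$. Define complementary subsets $D,U$ of $\{ -n+1,\dots,-1,1,\dots,n-1\}$: if $s_{i-1}\to s_i$ then $i\in D$ and $-i\in U$; if $s_{i-1}\leftarrow s_i$ then $i\in U$ and $-i\in D$. A signed permutation $\pi$ contains $\bar 231$ if there are positions $p<q<r$ in $\{ -n,\dots,-1,1,\dots,n\}$ (ordered as integers) with $\pi_r<\pi_p<\pi_q$ and $\pi_p\in U$; it contains $31\underline 2$ if there are positions $p<q<r$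 with $\pi_q<\pi_r<\pi_p$ and $\pi_r\in D$. By a result of Reading, $\mathcal B$ is a sublattice of weak order on $B_n$ isomorphic to the Cambrian lattice $C(\bar G)$ (a lattice quotient of weak order whose fibres have minimal elements exactly $\mathcal B$). A finite lattice is trim if, for some $m$, it has a maximal chain of $m+1$ left modular elements (an element $x$ is left modular if $(y\vee x)\wedge z=y\vee(x\wedge z)$ for all $y<z$) and has exactly $m$ join-irreducibles and exactly $m$ meet-irreducibles. -}

module Defs where

open import Data.Nat as ℕ using (ℕ; zero; suc; pred)
open import Data.Integer as ℤ using (ℤ; +_; -[1+_]; ∣_∣)
open import Data.Fin as Fin using (Fin; toℕ; inject₁)
open import Data.Vec as Vec using (Vec; lookup; toList)
open import Data.List using (List; applyUpTo)
open import Data.List.Relation.Binary.Permutation.Propositional using (_↭_)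
open import Data.List.Relation.Unary.Any using (Any)
open import Data.List.Relation.Unary.All using (All)
open import Data.List.Relation.Unary.AllPairs using (AllPairs)
open import Data.Product using (Σ; ∃; _×_; _,_)
open import Data.Sum using (_⊎_)
open import Data.Bool using (Bool; true; false)
open import Relation.Binary.PropositionalEquality using (_≡_)
open import Relation.Nullary using (¬_)

-- Generic order-theoretic notions for a poset (A, ≤).
-- Equality of elements is taken up to ≈ (mutual ≤).

module OrderNotions {A : Set} (_≤_ : A → A → Set) where

  _≈_ : A → A → Set
  x ≈ y = x ≤ y × y ≤ x

  _<_ : A → A → Set
  x < y = x ≤ y × ¬ (y ≤ x)

  _⋖_ : A → A → Set
  x ⋖ y = x < y × (∀ w → x < w → ¬ (w < y))

  IsBottom : A → Set
  IsBottom x = ∀ w → x ≤ w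

  IsTop : A → Set
  IsTop x = ∀ w → w ≤ x

  IsJoin : A → A → A → Set
  IsJoin x y j = x ≤ j × y ≤ j × (∀ u → x ≤ u → y ≤ u → j ≤ u)

  IsMeet : A → A → A → Set
  IsMeet x y m = m ≤ x × m ≤ y × (∀ u → u ≤ x → u ≤ y → u ≤ m)

  IsLattice : Set
  IsLattice = (∀ x y → ∃ λ j → IsJoin x y j) × (∀ x y → ∃ λ m → IsMeet x y m)

  LeftModular : A → Set
  LeftModular x = ∀ y z → y < z → ∀ a b c d →
    IsJoin y x a → IsMeet a z b → IsMeet x z c → IsJoin y c d → b ≈ d

  JoinIrreducible : A → Set
  JoinIrreducible x = ¬ IsBottom x × (∀ y z → IsJoin y z x → x ≈ y ⊎ x ≈ z)

  MeetIrreducible : A → Set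
  MeetIrreducible x = ¬ IsTop x × (∀ y z → IsMeet y z x → x ≈ y ⊎ x ≈ z)

  ExactlyCount : (A → Set) → ℕ → Set
  ExactlyCount P m = Σ (Vec A m) λ L →
    All P (toList L) ×
    AllPairs (λ a b → ¬ (a ≈ b)) (toList L) ×
    (∀ x → P x → Any (x ≈_) (toList L))

  MaximalChain : (m : ℕ) → Vec A (suc m) → Set
  MaximalChain m c = IsBottom (lookup c Fin.zero) × IsTop (lookup c (Fin.fromℕ m)) ×
    (∀ (i : Fin m) → lookup c (inject₁ i) ⋖ lookup c (Fin.suc i))

  IsTrim : Set
  IsTrim = IsLattice × (∃ λ m → (Σ (Vec A (suc m)) λ c →
             MaximalChain m c × (∀ i → LeftModular (lookup c i)))
           × ExactlyCount JoinIrreducible m × ExactlyCount MeetIrreducible m)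

-- Signed permutations of B_n, stored by π₁ … πₙ.

SignedPerm : ℕ → Set
SignedPerm n = Σ (Vec ℤ n) λ v → Data.List.map ∣_∣ (toList v) ↭ applyUpTo suc n
  where import Data.List

-- full one-line word π₋ₙ … π₋₁ π₁ … πₙ  (π₋ᵢ = -πᵢ)
word : ∀ {n} → SignedPerm n → Vec ℤ (n ℕ.+ n)
word (v , _) = Vec.reverse (Vec.map ℤ.-_ v) Vec.++ v

Precedes : ∀ {n} → SignedPerm n → ℤ → ℤ → Set
Precedes {n} π a b = Σ (Fin (n ℕ.+ n)) λ p → Σ (Fin (n ℕ.+ n)) λ q →
  p Fin.< q × lookup (word π) p ≡ a × lookup (word π) q ≡ b

-- positive roots of B_n
data Root (n : ℕ) : Set where
  e-diff : (i j : ℕ) → 0 ℕ.< i → i ℕ.< j → j ℕ.≤ n → Root n   -- e_j - e_i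
  e-short : (i : ℕ) → 0 ℕ.< i → i ℕ.≤ n → Root n
  e-sum : (i j : ℕ) → 0 ℕ.< i → i ℕ.< j → j ℕ.≤ n → Root n

Inv : ∀ {n} → SignedPerm n → Root n → Set
Inv π (e-diff i j _ _ _) = Precedes π (+ j) (+ i)
Inv π (e-short i _ _)    = Precedes π (+ i) (ℤ.- (+ i))
Inv π (e-sum i j _ _ _)  = Precedes π (+ i) (ℤ.- (+ j))

_≤W_ : ∀ {n} → SignedPerm n → SignedPerm n → Set
π ≤W σ = ∀ r → Inv π r → Inv σ r

-- Orientations of the B_n Coxeter diagram s₀ - s₁ - … - s_{n-1}.
-- G k (k : Fin (n-1)) concerns the edge i = k+1 between s_{i-1} and s_i:
-- true  means s_{i-1} → s_i,  false means s_{i-1} ← s_i.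

Orientation : ℕ → Set
Orientation n = Fin (pred n) → Bool

InD : ∀ {n} → Orientation n → ℤ → Set
InD {n} G z = Σ (Fin (pred n)) λ k →
  (z ≡ + suc (toℕ k) × G k ≡ true) ⊎ (z ≡ -[1+ toℕ k ] × G k ≡ false)

InU : ∀ {n} → Orientation n → ℤ → Set
InU {n} G z = Σ (Fin (pred n)) λ k →
  (z ≡ + suc (toℕ k) × G k ≡ false) ⊎ (z ≡ -[1+ toℕ k ] × G k ≡ true)

Contains231 : ∀ {n} → Orientation n → SignedPerm n → Set
Contains231 {n} G π = Σ (Fin (n ℕ.+ n)) λ p → Σ (Fin (n ℕ.+ n)) λ q → Σ (Fin (n ℕ.+ n)) λ r →
  p Fin.< q × q Fin.< r × w r ℤ.< w p × w p ℤ.< w q × InU {n} G (w p)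
  where w = lookup (word π)

Contains312 : ∀ {n} → Orientation n → SignedPerm n → Set
Contains312 {n} G π = Σ (Fin (n ℕ.+ n)) λ p → Σ (Fin (n ℕ.+ n)) λ q → Σ (Fin (n ℕ.+ n)) λ r →
  p Fin.< q × q Fin.< r × w q ℤ.< w r × w r ℤ.< w p × InD {n} G (w r)
  where w = lookup (word π)

CambrianB : (n : ℕ) → Orientation n → Set
CambrianB n G = Σ (SignedPerm n) λ π → ¬ Contains231 G π × ¬ Contains312 G π

_≤B_ : ∀ {n} {G : Orientation n} → CambrianB n G → CambrianB n G → Set
(π , _) ≤B (σ , _) = π ≤W σ

module Submission where

open import Defs
open import Data.Nat using (ℕ; _≤_)

open import Data.Nat as ℕ using (zero; suc; pred; z≤n; s≤s)
import Data.Nat.Properties as ℕₚ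
open import Data.Integer as ℤ using (ℤ; +_; -_; -[1+_]; ∣_∣; +<+; -<+; -<-; +≤+; -≤+)
import Data.Integer.Properties as ℤₚ
open import Data.Integer.Tactic.RingSolver using (solve-∀)
open import Data.Fin as Fin using (Fin; toℕ; inject₁; fromℕ; fromℕ<; opposite; _↑ˡ_; _↑ʳ_)
import Data.Fin.Properties as Finₚ
open import Data.Vec as Vec using (Vec; []; _∷_; lookup; toList; tabulate)
import Data.Vec.Properties as Vecₚ
import Data.Vec.Membership.Propositional.Properties as Vec∈ₚ
import Data.Vec.Relation.Unary.Any as VecAny
import Data.Vec.Relation.Unary.Any.Properties as VecAnyₚ
open import Data.List as List using (List; []; _∷_; applyUpTo; length)
import Data.List.Properties as Listₚ
open import Data.List.Membership.Propositional using (_∈_)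
import Data.List.Membership.Propositional.Properties as ∈ₚ
open import Data.List.Relation.Unary.Any using (Any; here; there)
open import Data.List.Relation.Unary.All using (All; []; _∷_)
open import Data.List.Relation.Unary.AllPairs using (AllPairs; []; _∷_)
open import Data.List.Relation.Unary.Unique.Propositional using (Unique)
import Data.List.Relation.Unary.Unique.Propositional.Properties as Uniqueₚ
open import Data.List.Relation.Unary.Sorted.TotalOrder.Properties using (Sorted⇒AllPairs)
open import Data.List.Relation.Binary.Permutation.Propositional
  using (_↭_; ↭-sym; ↭⇒↭ₛ; module PermutationReasoning)
import Data.List.Relation.Binary.Permutation.Propositional.Properties as ↭ₚ
import Data.List.Relation.Binary.Permutation.Setoid.Properties as ↭ₛₚ
import Data.List.Sort as Sort
open import Data.Product using (Σ; ∃; _×_; _,_; proj₁; proj₂)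
import Data.Product.Properties as Productₚ
open import Data.Sum as Sum using (_⊎_; inj₁; inj₂; [_,_]′)
open import Data.Bool using (Bool; true; false; not)
import Data.Bool.Properties as Boolₚ
open import Data.Empty using (⊥; ⊥-elim)
open import Function using (_∘_; id)
open import Relation.Nullary using (¬_; Dec; yes; no; contradiction)
open import Relation.Nullary.Decidable using (_×-dec_; _⊎-dec_; ¬?; map′; decidable-stable)
open import Relation.Unary using (Decidable)
open import Relation.Binary using (DecTotalOrder; tri<; tri≈; tri>)
open import Relation.Binary.PropositionalEquality as ≡
  using (_≡_; _≢_; refl; sym; trans; cong; cong₂; subst; subst₂)
import Relation.Binary.Construct.On as On
open import Relation.Binary.Construct.Closure.Transitive as Plus using (TransClosure; [_]; _∷_)

-- Record π by the pairs a < c of values with c before a.  The pattern conditions say that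
-- these relations are exactly the transitive ones, invariant under (a , c) ↦ (- c , - a), in
-- which a pair (a , c) forces (b , c) if b ∈ U, and (a , b) if b ∈ D, for a < b < c.  Hence
-- meet is intersection and join is the transitive closure of the union.  Rank the pairs by
-- height so that (b , c), (a , c), (a , b) are increasing if b ∈ U and decreasing if b ∈ D.
-- The initial segments of a ranking of the roots are then closed and left modular, and they
-- form a maximal chain with one step per root; every root k also contributes one
-- join-irreducible, the closure of k, and one meet-irreducible, the largest closed set that
-- contains all earlier roots but not k.

-- The inversion set of a word must also have a transitive complement. Here this is automatic: a
-- value `b` strictly between two entries lies in `U` or in `D`, so `(a , c)` always forces
-- `(b , c)` or `(a , b)`. A closed relation can therefore be sorted back into a word, and the
-- lattice argument is carried out on relations of integers rather than on permutations.
--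
-- The height has two demands to meet at once: a forced pair must be lower than the pair that forces
-- it, and a composite `(a , c)` must be lower than one of its factors `(a , b)` and `(b , c)`.
-- Placing `(a , c)` strictly between its factors, in the direction given by the side of `b`, meets
-- both.
--
-- The delicate object is `M k`: in a lattice that need not be distributive, the elements without
-- `k` need not be stable under joins. They are once all earlier roots are present. On a path that
-- composes to `k`, an intermediate value cuts `k` into two pairs, one of them lower than `k` and so
-- already in every element concerned.

module _ {A : Set} where

  All-tabulate : ∀ {P : A → Set} {m} (f : Fin m → A) → (∀ i → P (f i)) → All P (toList (tabulate f))
  All-tabulate {m = zero}  f p = []
  All-tabulate {m = suc m} f p = p Fin.zero ∷ All-tabulate (f ∘ Fin.suc) (p ∘ Fin.suc)

  AllPairs-tabulate : ∀ {R : A → A → Set} {m} (f : Fin m → A) →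
    (∀ {i j} → i Fin.< j → R (f i) (f j)) → AllPairs R (toList (tabulate f))
  AllPairs-tabulate {m = zero}  f r = []
  AllPairs-tabulate {m = suc m} f r =
    All-tabulate (f ∘ Fin.suc) (λ _ → r (s≤s z≤n)) ∷ AllPairs-tabulate (f ∘ Fin.suc) (r ∘ s≤s)

  Any-tabulate : ∀ {P : A → Set} {m} (f : Fin m → A) i → P (f i) → Any P (toList (tabulate f))
  Any-tabulate f Fin.zero    p = here p
  Any-tabulate f (Fin.suc i) p = there (Any-tabulate (f ∘ Fin.suc) i p)

  AllPairs-lookup : ∀ {R : A → A → Set} {m} (v : Vec A m) → AllPairs R (toList v) →
    ∀ {i j} → i Fin.< j → R (lookup v i) (lookup v j)
  AllPairs-lookup (x ∷ v) (px ∷ _) {Fin.zero} {Fin.suc j} _ = All-lookup v px j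
    where
    All-lookup : ∀ {P : A → Set} {m} (v : Vec A m) → All P (toList v) → ∀ i → P (lookup v i)
    All-lookup (x ∷ v) (p ∷ _) Fin.zero    = p
    All-lookup (x ∷ v) (_ ∷ p) (Fin.suc i) = All-lookup v p i
  AllPairs-lookup (x ∷ v) (_ ∷ ps) {Fin.suc i} {Fin.suc j} (s≤s i<j) = AllPairs-lookup v ps i<j

largest : ∀ {m} {P : Fin m → Set} → Decidable P →
  (∃ λ k → P k × (∀ i → P i → i Fin.≤ k)) ⊎ (∀ i → ¬ P i)
largest {zero}  P? = inj₂ λ ()
largest {suc m} P? with largest (P? ∘ Fin.suc) | P? Fin.zero
... | inj₁ (k , pk , max) | _ =
  inj₁ (Fin.suc k , pk , λ { Fin.zero _ → z≤n ; (Fin.suc i) pi → s≤s (max i pi) })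
... | inj₂ none | yes p₀ =
  inj₁ (Fin.zero , p₀ , λ { Fin.zero _ → z≤n ; (Fin.suc i) pi → ⊥-elim (none i pi) })
... | inj₂ none | no ¬p₀ = inj₂ λ { Fin.zero → ¬p₀ ; (Fin.suc i) → none i }

smallest : ∀ {m} {P : Fin m → Set} → Decidable P →
  (∃ λ k → P k × (∀ i → P i → k Fin.≤ i)) ⊎ (∀ i → ¬ P i)
smallest {zero}  P? = inj₂ λ ()
smallest {suc m} P? with P? Fin.zero | smallest (P? ∘ Fin.suc)
... | yes p₀ | _ = inj₁ (Fin.zero , p₀ , λ _ _ → z≤n)
... | no ¬p₀ | inj₁ (k , pk , min) =
  inj₁ (Fin.suc k , pk , λ { Fin.zero p₀ → ⊥-elim (¬p₀ p₀) ; (Fin.suc i) pi → s≤s (min i pi) })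
... | no ¬p₀ | inj₂ none = inj₂ λ { Fin.zero → ¬p₀ ; (Fin.suc i) → none i }

-- A lattice of subsets of Fin m, ordered by inclusion, that contains every initial
-- segment seg k = {0, …, k - 1}.  Its join-irreducibles are the least elements C k
-- containing k: an element x with maximum k is C k ∨ (x ∧ seg k).  Dually its
-- meet-irreducibles are the largest elements M k that contain seg k but not k: if k is the
-- first index missing from x, then left modularity of seg (k + 1) gives
-- x = M k ∧ (x ∨ seg (k + 1)).
module ClosureSystem
  {A : Set} (_≤A_ : A → A → Set) (m : ℕ)
  (mem : A → Fin m → Set) (mem? : ∀ x → Decidable (mem x))
  (≤⇒⊆ : ∀ {x y} → x ≤A y → ∀ i → mem x i → mem y i)
  (⊆⇒≤ : ∀ {x y} → (∀ i → mem x i → mem y i) → x ≤A y)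
  (seg : Fin (suc m) → A)
  (mem-seg⁺ : ∀ {k i} → toℕ i ℕ.< toℕ k → mem (seg k) i)
  (mem-seg⁻ : ∀ {k i} → mem (seg k) i → toℕ i ℕ.< toℕ k)
  (_∨_ _∧_ : A → A → A)
  (∨-isJoin : ∀ x y → OrderNotions.IsJoin _≤A_ x y (x ∨ y))
  (∧-isMeet : ∀ x y → OrderNotions.IsMeet _≤A_ x y (x ∧ y))
  (mem-∧ : ∀ {x y i} → mem x i → mem y i → mem (x ∧ y) i)
  (C : Fin m → A)
  (mem-C : ∀ k → mem (C k) k)
  (C-least : ∀ {x} k → mem x k → C k ≤A x)
  (M : Fin m → A)
  (mem-M : ∀ k → ¬ mem (M k) k)
  (seg≤M : ∀ k → seg (inject₁ k) ≤A M k)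
  (M-greatest : ∀ {x} k → seg (inject₁ k) ≤A x → ¬ mem x k → x ≤A M k)
  (seg-leftModular : ∀ k → OrderNotions.LeftModular _≤A_ (seg k))
  where

  open OrderNotions _≤A_ renaming (_<_ to _<A_)

  ≤-refl : ∀ {x} → x ≤A x
  ≤-refl = ⊆⇒≤ λ _ → id

  ≤-trans : ∀ {x y z} → x ≤A y → y ≤A z → x ≤A z
  ≤-trans p q = ⊆⇒≤ λ i → ≤⇒⊆ q i ∘ ≤⇒⊆ p i

  mem-seg-inject₁⁺ : ∀ {k i} → i Fin.< k → mem (seg (inject₁ k)) i
  mem-seg-inject₁⁺ {k} i<k = mem-seg⁺ (subst (_ ℕ.<_) (sym (Finₚ.toℕ-inject₁ k)) i<k)

  mem-seg-inject₁⁻ : ∀ {k i} → mem (seg (inject₁ k)) i → i Fin.< k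
  mem-seg-inject₁⁻ {k} p = subst (_ ℕ.<_) (Finₚ.toℕ-inject₁ k) (mem-seg⁻ p)

  ≤-split : ∀ {i k : Fin m} → i Fin.≤ k → i Fin.< k ⊎ i ≡ k
  ≤-split i≤k = Sum.map id Finₚ.toℕ-injective (ℕₚ.m≤n⇒m<n∨m≡n i≤k)

  isLattice : IsLattice
  isLattice = (λ x y → x ∨ y , ∨-isJoin x y) , (λ x y → x ∧ y , ∧-isMeet x y)

  seg-⋖ : ∀ k → seg (inject₁ k) ⋖ seg (Fin.suc k)
  seg-⋖ k = (⊆⇒≤ (λ i p → mem-seg⁺ (ℕₚ.<⇒≤ (s≤s (mem-seg-inject₁⁻ p))))
            , λ q → ℕₚ.<-irrefl refl (mem-seg-inject₁⁻ (≤⇒⊆ q k (mem-seg⁺ ℕₚ.≤-refl))))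
          , λ w (s≤w , w≰s) (w≤s' , s'≰w) → strict w s≤w w≰s w≤s' s'≰w
    where
    strict : ∀ w → seg (inject₁ k) ≤A w → ¬ (w ≤A seg (inject₁ k)) →
             w ≤A seg (Fin.suc k) → ¬ (seg (Fin.suc k) ≤A w) → ⊥
    strict w s≤w w≰s w≤s' s'≰w with mem? w k
    ... | yes wk = s'≰w (⊆⇒≤ λ i p → [ ≤⇒⊆ s≤w i ∘ mem-seg-inject₁⁺ , (λ { refl → wk }) ]′
                                        (≤-split (ℕₚ.≤-pred (mem-seg⁻ p))))
    ... | no ¬wk = w≰s (⊆⇒≤ λ i p → [ mem-seg-inject₁⁺ , (λ { refl → contradiction p ¬wk }) ]′
                                        (≤-split (ℕₚ.≤-pred (mem-seg⁻ (≤⇒⊆ w≤s' i p)))))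

  maximalChain : MaximalChain m (tabulate seg)
  maximalChain =
      (λ w → ⊆⇒≤ λ i p → contradiction (mem-seg⁻ p) ℕₚ.n≮0)
    , subst IsTop (sym (Vecₚ.lookup∘tabulate seg (fromℕ m)))
        (λ w → ⊆⇒≤ λ i _ → mem-seg⁺ (subst (toℕ i ℕ.<_) (sym (Finₚ.toℕ-fromℕ m)) (Finₚ.toℕ<n i)))
    , λ k → subst₂ _⋖_ (sym (Vecₚ.lookup∘tabulate seg (inject₁ k)))
                       (sym (Vecₚ.lookup∘tabulate seg (Fin.suc k))) (seg-⋖ k)

  -- `C k` lies inside the segment that ends with `k`, so an element below it that misses `k` lies
  -- inside the segment before `k`. The join of two such elements stays there and cannot reach `k`.
  C-joinIrreducible : ∀ k → JoinIrreducible (C k)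
  C-joinIrreducible k =
      (λ bot → ℕₚ.n≮0 (mem-seg⁻ (≤⇒⊆ (bot (seg Fin.zero)) k (mem-C k))))
    , irr
    where
    irr : ∀ y z → IsJoin y z (C k) → C k ≈ y ⊎ C k ≈ z
    irr y z (y≤ , z≤ , least) with mem? y k | mem? z k
    ... | yes yk | _ = inj₁ (C-least k yk , y≤)
    ... | no _ | yes zk = inj₂ (C-least k zk , z≤)
    ... | no ¬yk | no ¬zk = ⊥-elim (ℕₚ.<-irrefl refl (mem-seg-inject₁⁻
            (≤⇒⊆ (least (seg (inject₁ k)) (below y≤ ¬yk) (below z≤ ¬zk)) k (mem-C k))))
      where
      below : ∀ {u} → u ≤A C k → ¬ mem u k → u ≤A seg (inject₁ k)
      below u≤ ¬uk = ⊆⇒≤ λ i ui → [ mem-seg-inject₁⁺ , (λ { refl → contradiction ui ¬uk }) ]′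
        (≤-split (ℕₚ.≤-pred (mem-seg⁻ (≤⇒⊆ (C-least {seg (Fin.suc k)} k (mem-seg⁺ ℕₚ.≤-refl)) i
                                             (≤⇒⊆ u≤ i ui)))))

  joinIrreducible⇒C : ∀ x → JoinIrreducible x → ∃ λ k → x ≈ C k
  joinIrreducible⇒C x (x≢⊥ , irr) with largest (mem? x)
  ... | inj₂ none = ⊥-elim (x≢⊥ λ w → ⊆⇒≤ λ i → ⊥-elim ∘ none i)
  ... | inj₁ (k , xk , max) = k , [ id , (λ x≈ → ⊥-elim (ℕₚ.<-irrefl refl
            (mem-seg-inject₁⁻ (≤⇒⊆ (≤-trans (proj₁ x≈) ∧≤seg) k xk)))) ]′
          (irr (C k) (x ∧ seg (inject₁ k)) (C-least k xk , ∧≤x , join))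
    where
    ∧≤x = proj₁ (∧-isMeet x (seg (inject₁ k)))
    ∧≤seg = proj₁ (proj₂ (∧-isMeet x (seg (inject₁ k))))
    join : ∀ u → C k ≤A u → (x ∧ seg (inject₁ k)) ≤A u → x ≤A u
    join u C≤u ∧≤u = ⊆⇒≤ λ i xi →
      [ (λ i<k → ≤⇒⊆ ∧≤u i (mem-∧ xi (mem-seg-inject₁⁺ i<k)))
      , (λ { refl → ≤⇒⊆ C≤u k (mem-C k) }) ]′ (≤-split (max i xi))

  C-distinct : ∀ {i j} → i Fin.< j → ¬ (C i ≈ C j)
  C-distinct {i} {j} i<j (_ , Cj≤Ci) = ℕₚ.<⇒≱ i<j (ℕₚ.≤-pred (mem-seg⁻
    (≤⇒⊆ (≤-trans Cj≤Ci (C-least {seg (Fin.suc i)} i (mem-seg⁺ ℕₚ.≤-refl))) j (mem-C j))))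

  M-meetIrreducible : ∀ k → MeetIrreducible (M k)
  M-meetIrreducible k =
      (λ top → mem-M k (≤⇒⊆ (top (C k)) k (mem-C k)))
    , irr
    where
    irr : ∀ y z → IsMeet y z (M k) → M k ≈ y ⊎ M k ≈ z
    irr y z (≤y , ≤z , greatest) with mem? y k | mem? z k
    ... | no ¬yk | _ = inj₁ (≤y , M-greatest k (≤-trans (seg≤M k) ≤y) ¬yk)
    ... | yes _ | no ¬zk = inj₂ (≤z , M-greatest k (≤-trans (seg≤M k) ≤z) ¬zk)
    ... | yes yk | yes zk =
      ⊥-elim (mem-M k (≤⇒⊆ (greatest (C k) (C-least k yk) (C-least k zk)) k (mem-C k)))

  meetIrreducible⇒M : ∀ x → MeetIrreducible x → ∃ λ k → x ≈ M k
  meetIrreducible⇒M x (x≢⊤ , irr) with smallest (¬? ∘ mem? x)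
  ... | inj₂ all = ⊥-elim (x≢⊤ λ w → ⊆⇒≤ λ i _ → decidable-stable (mem? x i) (all i))
  ... | inj₁ (k , ¬xk , min) = k , (x≤M , M≤x)
    where
    before : ∀ {i} → i Fin.< k → mem x i
    before i<k = decidable-stable (mem? x _) λ ¬xi → ℕₚ.<⇒≱ i<k (min _ ¬xi)

    x≤M : x ≤A M k
    x≤M = M-greatest k (⊆⇒≤ λ i p → before (mem-seg-inject₁⁻ p)) ¬xk

    s = seg (Fin.suc k)

    M≤x : M k ≤A x
    -- Left modularity speaks of strict pairs only, so an index that separates `M k` from `x` is
    -- sought first; without one the inclusion is immediate.
    M≤x with Finₚ.any? (λ i → mem? (M k) i ×-dec ¬? (mem? x i))
    ... | no ∄ = ⊆⇒≤ λ i p → decidable-stable (mem? x i) λ ¬xi → ∄ (i , p , ¬xi)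
    ... | yes (i , Mi , ¬xi) = [ proj₂ , (λ x≈ → ⊥-elim (¬xk (≤⇒⊆ (proj₂ x≈) k
              (≤⇒⊆ (proj₁ (proj₂ (∨-isJoin x s))) k (mem-seg⁺ ℕₚ.≤-refl))))) ]′
          (irr (M k) (x ∨ s) (x≤M , proj₁ (∨-isJoin x s) , meet))
      where
      s∧M≤x : (s ∧ M k) ≤A x
      s∧M≤x = ⊆⇒≤ λ i p →
        [ before , (λ { refl → ⊥-elim (mem-M k (≤⇒⊆ (proj₁ (proj₂ (∧-isMeet s (M k)))) k p)) }) ]′
        (≤-split (ℕₚ.≤-pred (mem-seg⁻ (≤⇒⊆ (proj₁ (∧-isMeet s (M k))) i p))))

      modular : ((x ∨ s) ∧ M k) ≈ (x ∨ (s ∧ M k))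
      modular = seg-leftModular (Fin.suc k) x (M k) (x≤M , λ M≤x → ¬xi (≤⇒⊆ M≤x i Mi))
        _ _ _ _ (∨-isJoin x s) (∧-isMeet (x ∨ s) (M k)) (∧-isMeet s (M k)) (∨-isJoin x (s ∧ M k))

      meet : ∀ u → u ≤A M k → u ≤A (x ∨ s) → u ≤A x
      meet u u≤M u≤∨ =
        ≤-trans (proj₂ (proj₂ (∧-isMeet (x ∨ s) (M k))) u u≤∨ u≤M)
        (≤-trans (proj₁ modular)
                 (proj₂ (proj₂ (∨-isJoin x (s ∧ M k))) x ≤-refl s∧M≤x))

  M-distinct : ∀ {i j} → i Fin.< j → ¬ (M i ≈ M j)
  M-distinct {i} {j} i<j (_ , Mj≤Mi) =
    mem-M i (≤⇒⊆ (≤-trans (seg≤M j) Mj≤Mi) i (mem-seg-inject₁⁺ i<j))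

  isTrim : IsTrim
  isTrim = isLattice , m
    , (tabulate seg , maximalChain
      , λ i → subst LeftModular (sym (Vecₚ.lookup∘tabulate seg i)) (seg-leftModular i))
    , (tabulate C , All-tabulate C C-joinIrreducible , AllPairs-tabulate C C-distinct
      , λ x ji → let k , x≈ = joinIrreducible⇒C x ji in Any-tabulate C k x≈)
    , (tabulate M , All-tabulate M M-meetIrreducible , AllPairs-tabulate M M-distinct
      , λ x mi → let k , x≈ = meetIrreducible⇒M x mi in Any-tabulate M k x≈)

-- Vectors without repetition, and the entries of signed words.

module _ {A : Set} where

  Unique-resp-↭ : ∀ {xs ys : List A} → xs ↭ ys → Unique xs → Unique ys
  Unique-resp-↭ p = ↭ₛₚ.Unique-resp-↭ (≡.setoid A) (↭⇒↭ₛ p)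

  lookup-injective : ∀ {m} (v : Vec A m) → Unique (toList v) → ∀ {i j} →
    lookup v i ≡ lookup v j → i ≡ j
  lookup-injective v u {i} {j} eq with Finₚ.<-cmp i j
  ... | tri< i<j _ _ = contradiction eq (AllPairs-lookup v u i<j)
  ... | tri≈ _ i≡j _ = i≡j
  ... | tri> _ _ j<i = contradiction (sym eq) (AllPairs-lookup v u j<i)

  lookup-surjective : ∀ {m} (v : Vec A m) {x} → x ∈ toList v → ∃ λ i → lookup v i ≡ x
  lookup-surjective v x∈ =
    let x∈v = Vec∈ₚ.∈-toList⁻ x∈ in VecAny.index x∈v , sym (VecAnyₚ.lookup-index x∈v)

  lookup∈toList : ∀ {m} (v : Vec A m) i → lookup v i ∈ toList v
  lookup∈toList v i = Vec∈ₚ.∈-toList⁺ (Vec∈ₚ.∈-lookup i v)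

data IsEntry (n : ℕ) : ℤ → Set where
  pos : ∀ {i} → i ℕ.< n → IsEntry n (+ suc i)
  neg : ∀ {i} → i ℕ.< n → IsEntry n -[1+ i ]

module _ {n : ℕ} where

  isEntry? : Decidable (IsEntry n)
  isEntry? (+ zero)  = no λ ()
  isEntry? (+ suc i) = map′ pos (λ { (pos p) → p }) (i ℕ.<? n)
  isEntry? -[1+ i ]  = map′ neg (λ { (neg p) → p }) (i ℕ.<? n)

  -‿isEntry : ∀ {z} → IsEntry n z → IsEntry n (- z)
  -‿isEntry (pos p) = neg p
  -‿isEntry (neg p) = pos p

  entry≤n : ∀ {z} → IsEntry n z → z ℤ.≤ + n
  entry≤n (pos p) = +≤+ p
  entry≤n (neg p) = -≤+

entries : ℕ → List ℤ
entries n = List.map (+_ ∘ suc) (List.upTo n) List.++ List.map -[1+_] (List.upTo n)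

∈-entries : ∀ {n z} → IsEntry n z → z ∈ entries n
∈-entries (pos p) = ∈ₚ.∈-++⁺ˡ (∈ₚ.∈-map⁺ _ (∈ₚ.∈-upTo⁺ p))
∈-entries (neg p) = ∈ₚ.∈-++⁺ʳ _ (∈ₚ.∈-map⁺ _ (∈ₚ.∈-upTo⁺ p))

entries-isEntry : ∀ {n z} → z ∈ entries n → IsEntry n z
entries-isEntry {n} z∈ with ∈ₚ.∈-++⁻ (List.map (+_ ∘ suc) (List.upTo n)) z∈
... | inj₁ z∈⁺ with _ , i∈ , refl ← ∈ₚ.∈-map⁻ _ z∈⁺ = pos (∈ₚ.∈-upTo⁻ i∈)
... | inj₂ z∈⁻ with _ , i∈ , refl ← ∈ₚ.∈-map⁻ _ z∈⁻ = neg (∈ₚ.∈-upTo⁻ i∈)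

entries-unique : ∀ n → Unique (entries n)
entries-unique n = Uniqueₚ.++⁺
  (Uniqueₚ.map⁺ (λ { refl → refl }) (Uniqueₚ.upTo⁺ n))
  (Uniqueₚ.map⁺ (λ { refl → refl }) (Uniqueₚ.upTo⁺ n)) disjoint
  where
  disjoint : ∀ {z} → ¬ (z ∈ List.map (+_ ∘ suc) (List.upTo n) × z ∈ List.map -[1+_] (List.upTo n))
  disjoint (z∈⁺ , z∈⁻) with ∈ₚ.∈-map⁻ _ z∈⁺ | ∈ₚ.∈-map⁻ _ z∈⁻
  ... | _ , _ , refl | _ , _ , ()

-- Warshall's algorithm: the list bounds the intermediate vertices of a path.
module Reachability {A : Set} {R : A → A → Set} (R? : ∀ a c → Dec (R a c)) where

  Reach : List A → A → A → Set
  Reach []       a c = R a c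
  Reach (b ∷ bs) a c = Reach bs a c ⊎ (Reach bs a b × Reach bs b c)

  reach? : ∀ bs a c → Dec (Reach bs a c)
  reach? []       a c = R? a c
  reach? (b ∷ bs) a c = reach? bs a c ⊎-dec (reach? bs a b ×-dec reach? bs b c)

  reach-edge : ∀ bs {a c} → R a c → Reach bs a c
  reach-edge []       r = r
  reach-edge (b ∷ bs) r = inj₁ (reach-edge bs r)

  reach-trans : ∀ {bs a b c} → b ∈ bs → Reach bs a b → Reach bs b c → Reach bs a c
  reach-trans {b′ ∷ bs} (here refl) p q = inj₂ ([ id , proj₁ ]′ p , [ id , proj₂ ]′ q)
  reach-trans {b′ ∷ bs} (there b∈) (inj₁ p) (inj₁ q) = inj₁ (reach-trans b∈ p q)
  reach-trans {b′ ∷ bs} (there b∈) (inj₁ p) (inj₂ (q , q′)) = inj₂ (reach-trans b∈ p q , q′)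
  reach-trans {b′ ∷ bs} (there b∈) (inj₂ (p , p′)) (inj₁ q) = inj₂ (p , reach-trans b∈ p′ q)
  -- Both paths visit `b′`; the detour between the two visits is cut out.
  reach-trans {b′ ∷ bs} (there b∈) (inj₂ (p , _)) (inj₂ (_ , q′)) = inj₂ (p , q′)

  reach⇒⁺ : ∀ bs {a c} → Reach bs a c → TransClosure R a c
  reach⇒⁺ []       r              = [ r ]
  reach⇒⁺ (b ∷ bs) (inj₁ p)       = reach⇒⁺ bs p
  reach⇒⁺ (b ∷ bs) (inj₂ (p , q)) = reach⇒⁺ bs p Plus.++ reach⇒⁺ bs q

  ⁺⇒reach : ∀ bs → (∀ {a b} → R a b → b ∈ bs) → ∀ {a c} → TransClosure R a c → Reach bs a c
  ⁺⇒reach bs ∈bs [ r ]   = reach-edge bs r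
  ⁺⇒reach bs ∈bs (r ∷ p) = reach-trans (∈bs r) (reach-edge bs r) (⁺⇒reach bs ∈bs p)

  _⁺? : ∀ bs → (∀ {a b} → R a b → b ∈ bs) → ∀ a c → Dec (TransClosure R a c)
  (bs ⁺?) ∈bs a c = map′ (reach⇒⁺ bs) (⁺⇒reach bs ∈bs) (reach? bs a c)

-- Pairs of entries and their heights.

<-by-difference : ∀ {x y} d → + 0 ℤ.< d → y ≡ x ℤ.+ d → x ℤ.< y
<-by-difference {x} d 0<d refl = subst (ℤ._< x ℤ.+ d) (ℤₚ.+-identityʳ x) (ℤₚ.+-monoʳ-< x 0<d)

0<difference : ∀ {a b} → a ℤ.< b → + 0 ℤ.< b ℤ.+ - a
0<difference {a} {b} a<b = subst (ℤ._< b ℤ.+ - a) (ℤₚ.+-inverseʳ a) (ℤₚ.+-monoˡ-< (- a) a<b)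

-- Pairs a < c of entries stand for roots, with (a , c) and (- c , - a) the same root.
-- up z means z ∈ U.
module Cambrian (n : ℕ) (up : ℤ → Bool)
  (up-neg : ∀ {z} → IsEntry n z → up (- z) ≡ not (up z)) where

  IsRoot : ℤ → ℤ → Set
  IsRoot a c = IsEntry n a × IsEntry n c × a ℤ.< c

  isRoot? : ∀ a c → Dec (IsRoot a c)
  isRoot? a c = isEntry? a ×-dec isEntry? c ×-dec (a ℤ.<? c)

  -‿isRoot : ∀ {a c} → IsRoot a c → IsRoot (- c) (- a)
  -‿isRoot (ea , ec , a<c) = -‿isEntry ec , -‿isEntry ea , ℤₚ.neg-mono-< a<c

  up-neg-false : ∀ {b} → IsEntry n b → up b ≡ false → up (- b) ≡ true
  up-neg-false eb b∈D = trans (up-neg eb) (cong not b∈D)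

  -- With points of U on a concave arc and points of D on its central reflection, height
  -- orders the pairs as the slopes of their chords do.
  K : ℤ
  K = + 1 ℤ.+ (+ n ℤ.+ + n)

  height-of : Bool → Bool → ℤ → ℤ → ℤ
  height-of true  true  a c = - (a ℤ.+ c)
  height-of false false a c = a ℤ.+ c
  height-of false true  a c = K ℤ.+ - (c ℤ.+ - a)
  height-of true  false a c = (c ℤ.+ - a) ℤ.+ - K

  height : ℤ → ℤ → ℤ
  height a c = height-of (up a) (up c) a c

  height-neg : ∀ {a c} → IsEntry n a → IsEntry n c → height (- c) (- a) ≡ height a c
  height-neg {a} {c} ea ec rewrite up-neg ea | up-neg ec with up a | up c
  ... | true  | true  = eq a c
    where
    eq : ∀ a c → (- c ℤ.+ - a) ≡ - (a ℤ.+ c)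
    eq = solve-∀
  ... | true  | false = eq K a c
    where
    eq : ∀ k a c → (- a ℤ.+ - (- c)) ℤ.+ - k ≡ (c ℤ.+ - a) ℤ.+ - k
    eq = solve-∀
  ... | false | true  = eq K a c
    where
    eq : ∀ k a c → k ℤ.+ - (- a ℤ.+ - (- c)) ≡ k ℤ.+ - (c ℤ.+ - a)
    eq = solve-∀
  ... | false | false = eq a c
    where
    eq : ∀ a c → - (- c ℤ.+ - a) ≡ a ℤ.+ c
    eq = solve-∀

  -- `K` is `2n + 1`, while a sum of two entries is at least `- 2n`. Besides `b - a` and `c - b`,
  -- the only gaps between heights that occur in `height-up` are `K + (a + b)` and `K - (b + c)`.
  0<K+ : ∀ {a b} → IsEntry n a → IsEntry n b → + 0 ℤ.< K ℤ.+ (a ℤ.+ b)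
  0<K+ {a} {b} ea eb = subst (+ 0 ℤ.<_) (eq (+ n) a b)
    (ℤₚ.+-mono-<-≤ {+ 0} {+ 1} (+<+ (s≤s z≤n)) (ℤₚ.+-mono-≤ (0≤n+ ea) (0≤n+ eb)))
    where
    0≤n+ : ∀ {a} → IsEntry n a → + 0 ℤ.≤ + n ℤ.+ a
    0≤n+ {a} ea = subst (λ b → + 0 ℤ.≤ + n ℤ.+ b) (ℤₚ.neg-involutive a)
      (ℤₚ.i≤j⇒0≤j-i (entry≤n (-‿isEntry ea)))
    eq : ∀ n a b → + 1 ℤ.+ ((n ℤ.+ a) ℤ.+ (n ℤ.+ b)) ≡ (+ 1 ℤ.+ (n ℤ.+ n)) ℤ.+ (a ℤ.+ b)
    eq = solve-∀

  height-up : ∀ {a b c} → IsEntry n a → IsEntry n b → IsEntry n c → a ℤ.< b → b ℤ.< c →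
    up b ≡ true → height b c ℤ.< height a c × height a c ℤ.< height a b
  height-up {a} {b} {c} ea eb ec a<b b<c b∈U rewrite b∈U with up a | up c
  ... | true  | true  = <-by-difference _ (0<difference a<b) (eq₁ a b c)
                      , <-by-difference _ (0<difference b<c) (eq₂ a b c)
    where
    eq₁ : ∀ a b c → - (a ℤ.+ c) ≡ - (b ℤ.+ c) ℤ.+ (b ℤ.+ - a)
    eq₁ = solve-∀
    eq₂ : ∀ a b c → - (a ℤ.+ b) ≡ - (a ℤ.+ c) ℤ.+ (c ℤ.+ - b)
    eq₂ = solve-∀
  ... | false | true  = <-by-difference _ (0<K+ ea eb) (eq₁ K a b c)
                      , <-by-difference _ (0<difference b<c) (eq₂ K a b c)
    where
    eq₁ : ∀ k a b c → k ℤ.+ - (c ℤ.+ - a) ≡ - (b ℤ.+ c) ℤ.+ (k ℤ.+ (a ℤ.+ b))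
    eq₁ = solve-∀
    eq₂ : ∀ k a b c → k ℤ.+ - (b ℤ.+ - a) ≡ (k ℤ.+ - (c ℤ.+ - a)) ℤ.+ (c ℤ.+ - b)
    eq₂ = solve-∀
  ... | true  | false = <-by-difference _ (0<difference a<b) (eq₁ K a b c)
                      , <-by-difference _ (0<K+ (-‿isEntry eb) (-‿isEntry ec)) (eq₂ K a b c)
    where
    eq₁ : ∀ k a b c → (c ℤ.+ - a) ℤ.+ - k ≡ ((c ℤ.+ - b) ℤ.+ - k) ℤ.+ (b ℤ.+ - a)
    eq₁ = solve-∀
    eq₂ : ∀ k a b c → - (a ℤ.+ b) ≡ ((c ℤ.+ - a) ℤ.+ - k) ℤ.+ (k ℤ.+ (- b ℤ.+ - c))
    eq₂ = solve-∀
  ... | false | false = <-by-difference _ (0<K+ ea eb) (eq₁ K a b c)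
                      , <-by-difference _ (0<K+ (-‿isEntry eb) (-‿isEntry ec)) (eq₂ K a b c)
    where
    eq₁ : ∀ k a b c → a ℤ.+ c ≡ ((c ℤ.+ - b) ℤ.+ - k) ℤ.+ (k ℤ.+ (a ℤ.+ b))
    eq₁ = solve-∀
    eq₂ : ∀ k a b c → k ℤ.+ - (b ℤ.+ - a) ≡ (a ℤ.+ c) ℤ.+ (k ℤ.+ (- b ℤ.+ - c))
    eq₂ = solve-∀

  height-down : ∀ {a b c} → IsEntry n a → IsEntry n b → IsEntry n c → a ℤ.< b → b ℤ.< c →
    up b ≡ false → height a b ℤ.< height a c × height a c ℤ.< height b c
  height-down ea eb ec a<b b<c b∈D =
    let p , q = height-up (-‿isEntry ec) (-‿isEntry eb) (-‿isEntry ea)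
                  (ℤₚ.neg-mono-< b<c) (ℤₚ.neg-mono-< a<b) (up-neg-false eb b∈D)
    in subst₂ ℤ._<_ (height-neg ea eb) (height-neg ea ec) p
     , subst₂ ℤ._<_ (height-neg ea ec) (height-neg eb ec) q

  -- Relations stable under forcing, and their transitive closures.

  record IsDown (R : ℤ → ℤ → Set) : Set where
    field
      dec    : ∀ a c → Dec (R a c)
      isRoot : ∀ {a c} → R a c → IsRoot a c
      symm   : ∀ {a c} → R a c → R (- c) (- a)
      up-R   : ∀ {a b c} → R a c → IsEntry n b → a ℤ.< b → b ℤ.< c → up b ≡ true → R b c

    unsymm : ∀ {a c} → R (- c) (- a) → R a c
    unsymm r = subst₂ R (ℤₚ.neg-involutive _) (ℤₚ.neg-involutive _) (symm r)

    -- Negation exchanges `U` and `D` and the two ends of a pair, so forcing through `D` is forcing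
    -- through `U` seen in the mirror.
    down-R : ∀ {a b c} → R a c → IsEntry n b → a ℤ.< b → b ℤ.< c → up b ≡ false → R a b
    down-R r eb a<b b<c b∈D = unsymm
      (up-R (symm r) (-‿isEntry eb) (ℤₚ.neg-mono-< b<c) (ℤₚ.neg-mono-< a<b) (up-neg-false eb b∈D))

  record IsClosed (R : ℤ → ℤ → Set) : Set where
    field
      isDown  : IsDown R
      R-trans : ∀ {a b c} → R a b → R b c → R a c
    open IsDown isDown public

  ∩-isClosed : ∀ {R S} → IsClosed R → IsClosed S → IsClosed (λ a c → R a c × S a c)
  ∩-isClosed R-cl S-cl = record
    { isDown = record
      { dec    = λ a c → R.dec a c ×-dec S.dec a c
      ; isRoot = R.isRoot ∘ proj₁
      ; symm   = λ (r , s) → R.symm r , S.symm s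
      ; up-R   = λ (r , s) eb a<b b<c b∈U → R.up-R r eb a<b b<c b∈U , S.up-R s eb a<b b<c b∈U }
    ; R-trans = λ (r , s) (r′ , s′) → R.R-trans r r′ , S.R-trans s s′ }
    where
    module R = IsClosed R-cl
    module S = IsClosed S-cl

  ∪-isDown : ∀ {R S} → IsDown R → IsDown S → IsDown (λ a c → R a c ⊎ S a c)
  ∪-isDown R-d S-d = record
    { dec    = λ a c → R.dec a c ⊎-dec S.dec a c
    ; isRoot = [ R.isRoot , S.isRoot ]′
    ; symm   = Sum.map R.symm S.symm
    ; up-R   = λ r eb a<b b<c b∈U → Sum.map (λ r → R.up-R r eb a<b b<c b∈U)
                                            (λ s → S.up-R s eb a<b b<c b∈U) r }
    where
    module R = IsDown R-d
    module S = IsDown S-d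

  ⁺-isRoot : ∀ {R} → IsDown R → ∀ {a c} → TransClosure R a c → IsRoot a c
  ⁺-isRoot R-d [ r ]   = IsDown.isRoot R-d r
  ⁺-isRoot R-d (r ∷ p) =
    let ea , _ , a<b = IsDown.isRoot R-d r ; _ , ec , b<c = ⁺-isRoot R-d p
    in ea , ec , ℤₚ.<-trans a<b b<c

  -- A point `b` of `U` is either a vertex of the path from `a` to `c` or lies inside one of its
  -- steps. Shrinking that step to start at `b` and dropping the earlier ones leaves a path from `b`
  -- to `c`.
  ⁺-isClosed : ∀ {R} → IsDown R → IsClosed (TransClosure R)
  ⁺-isClosed {R} R-d = record
    { isDown = record
      { dec    = (entries n ⁺?) (∈-entries ∘ proj₁ ∘ proj₂ ∘ isRoot)
      ; isRoot = ⁺-isRoot R-d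
      ; symm   = ⁺-symm
      ; up-R   = ⁺-up }
    ; R-trans = Plus._++_ }
    where
    open IsDown R-d
    open Reachability dec
    ⁺-symm : ∀ {a c} → TransClosure R a c → TransClosure R (- c) (- a)
    ⁺-symm [ r ]   = [ symm r ]
    ⁺-symm (r ∷ p) = ⁺-symm p Plus.∷ʳ symm r
    ⁺-up : ∀ {a b c} → TransClosure R a c → IsEntry n b → a ℤ.< b → b ℤ.< c → up b ≡ true →
           TransClosure R b c
    ⁺-up [ r ] eb a<b b<c b∈U = [ up-R r eb a<b b<c b∈U ]
    ⁺-up {b = b} (_∷_ {y = a′} r p) eb a<b b<c b∈U with ℤₚ.<-cmp b a′
    ... | tri< b<a′ _ _ = up-R r eb a<b b<a′ b∈U ∷ p
    ... | tri≈ _ refl _ = p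
    ... | tri> _ _ a′<b = ⁺-up p eb a′<b b<c b∈U

  ⁺-least : ∀ {R S : ℤ → ℤ → Set} → (∀ {a b c} → S a b → S b c → S a c) →
    (∀ {a c} → R a c → S a c) → ∀ {a c} → TransClosure R a c → S a c
  ⁺-least S-trans R⊆S [ r ]   = R⊆S r
  ⁺-least S-trans R⊆S (r ∷ p) = S-trans (R⊆S r) (⁺-least S-trans R⊆S p)

  -- The pairs forced by (a , c).
  Below : ℤ → ℤ → ℤ → ℤ → Set
  Below a c x y =
    IsRoot x y × (x ≡ a ⊎ (a ℤ.< x × up x ≡ true)) × (y ≡ c ⊎ (y ℤ.< c × up y ≡ false))

  Below-symm : ∀ {a c x y} → Below a c x y → Below (- c) (- a) (- y) (- x)
  Below-symm (r@(ex , ey , _) , p , q) = -‿isRoot r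
    , Sum.map (cong -_) (λ (y<c , y∈D) → ℤₚ.neg-mono-< y<c , up-neg-false ey y∈D) q
    , Sum.map (cong -_) (λ (a<x , x∈U) → ℤₚ.neg-mono-< a<x , trans (up-neg ex) (cong not x∈U)) p

  Below-up : ∀ {a c x b y} → Below a c x y → IsEntry n b → x ℤ.< b → b ℤ.< y → up b ≡ true →
    Below a c b y
  Below-up ((_ , ey , _) , p , q) eb x<b b<y b∈U =
    (eb , ey , b<y) , inj₂ (a<b p , b∈U) , q
    where
    a<b = [ (λ { refl → x<b }) , (λ (a<x , _) → ℤₚ.<-trans a<x x<b) ]′

  -- Forcing moves one end at a time: the left end goes to `x` through `U`, then the right end goes
  -- to `y` through `D`.
  Below-least : ∀ {R} → IsDown R → ∀ {a c} → R a c → ∀ {x y} → Below a c x y → R x y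
  Below-least R-d {a} {c} r {x} {y} ((ex , ey , x<y) , p , q) = shrinkʳ q (shrinkˡ p)
    where
    open IsDown R-d
    shrinkˡ : x ≡ a ⊎ (a ℤ.< x × up x ≡ true) → _
    shrinkˡ (inj₁ refl)        = r
    shrinkˡ (inj₂ (a<x , x∈U)) =
      up-R r ex a<x ([ (λ { refl → x<y }) , (λ (y<c , _) → ℤₚ.<-trans x<y y<c) ]′ q) x∈U
    shrinkʳ : y ≡ c ⊎ (y ℤ.< c × up y ≡ false) → _ → _
    shrinkʳ (inj₁ refl)        r = r
    shrinkʳ (inj₂ (y<c , y∈D)) r = down-R r ey x<y y<c y∈D

  -- A root has two representatives, and forcing starts from both; this makes the relation symmetric
  -- under negation.
  SymBelow : ℤ → ℤ → ℤ → ℤ → Set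
  SymBelow a c x y = Below a c x y ⊎ Below (- c) (- a) x y

  SymBelow-isDown : ∀ a c → IsDown (SymBelow a c)
  SymBelow-isDown a c = record
    { dec    = λ x y → below? a c x y ⊎-dec below? (- c) (- a) x y
    ; isRoot = [ proj₁ , proj₁ ]′
    ; symm   = [ inj₂ ∘ Below-symm
               , inj₁ ∘ subst₂ (λ a c → Below a c _ _) (ℤₚ.neg-involutive a) (ℤₚ.neg-involutive c)
                      ∘ Below-symm ]′
    ; up-R   = λ p eb x<b b<y b∈U → Sum.map (λ p → Below-up p eb x<b b<y b∈U)
                                            (λ p → Below-up p eb x<b b<y b∈U) p }
    where
    below? : ∀ a c x y → Dec (Below a c x y)
    below? a c x y = isRoot? x y
      ×-dec ((x ℤ.≟ a) ⊎-dec ((a ℤ.<? x) ×-dec (up x Boolₚ.≟ true)))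
      ×-dec ((y ℤ.≟ c) ⊎-dec ((y ℤ.<? c) ×-dec (up y Boolₚ.≟ false)))

  Generated : ℤ → ℤ → ℤ → ℤ → Set
  Generated a c = TransClosure (SymBelow a c)

  Generated-isClosed : ∀ a c → IsClosed (Generated a c)
  Generated-isClosed a c = ⁺-isClosed (SymBelow-isDown a c)

  Generated-self : ∀ {a c} → IsRoot a c → Generated a c a c
  Generated-self r = [ inj₁ (r , inj₁ refl , inj₁ refl) ]

  Generated-least : ∀ {R a c} → IsClosed R → R a c → ∀ {x y} → Generated a c x y → R x y
  Generated-least R-cl r = ⁺-least R-trans [ Below-least isDown r , Below-least isDown (symm r) ]′
    where open IsClosed R-cl

  -- The list of roots, one canonical pair for each, sorted by height.

  Canonical : ℤ × ℤ → Set
  Canonical (a , c) = - c ℤ.≤ a × a ℤ.< c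

  canonical? : Decidable Canonical
  canonical? (a , c) = (- c ℤ.≤? a) ×-dec (a ℤ.<? c)

  unsortedRoots : List (ℤ × ℤ)
  unsortedRoots = List.filter canonical? (List.cartesianProduct (entries n) (entries n))

  byHeight : DecTotalOrder _ _ _
  byHeight = On.decTotalOrder ℤₚ.≤-decTotalOrder (λ (r : ℤ × ℤ) → height (proj₁ r) (proj₂ r))

  open Sort byHeight using (sort; sort-↭; sort-↗)

  sortedRoots : List (ℤ × ℤ)
  sortedRoots = sort unsortedRoots

  rootCount : ℕ
  rootCount = length sortedRoots

  roots : Vec (ℤ × ℤ) rootCount
  roots = Vec.fromList sortedRoots

  lo hi : Fin rootCount → ℤ
  lo i = proj₁ (lookup roots i)
  hi i = proj₂ (lookup roots i)

  root-canonical : ∀ i → IsEntry n (lo i) × IsEntry n (hi i) × Canonical (lookup roots i)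
  root-canonical i =
    let i∈ , can = ∈ₚ.∈-filter⁻ canonical? (↭ₚ.∈-resp-↭ (sort-↭ unsortedRoots)
                     (Vec∈ₚ.∈-fromList⁻ (Vec∈ₚ.∈-lookup i roots)))
        lo∈ , hi∈ = ∈ₚ.∈-cartesianProduct⁻ (entries n) (entries n) i∈
    in entries-isEntry lo∈ , entries-isEntry hi∈ , can

  root-isRoot : ∀ i → IsRoot (lo i) (hi i)
  root-isRoot i = let el , eh , _ , l<h = root-canonical i in el , eh , l<h

  Represents : Fin rootCount → ℤ → ℤ → Set
  Represents i a c = lookup roots i ≡ (a , c) ⊎ lookup roots i ≡ (- c , - a)

  canonical-represented : ∀ {a c} → IsRoot a c → - c ℤ.≤ a → ∃ λ i → lookup roots i ≡ (a , c)
  canonical-represented (ea , ec , a<c) can = lookup-surjective roots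
    (subst (_ ∈_) (sym (Vecₚ.toList∘fromList sortedRoots))
      (↭ₚ.∈-resp-↭ (↭-sym (sort-↭ unsortedRoots))
        (∈ₚ.∈-filter⁺ canonical?
          (∈ₚ.∈-cartesianProduct⁺ (∈-entries ea) (∈-entries ec)) (can , a<c))))

  represented : ∀ {a c} → IsRoot a c → ∃ λ i → Represents i a c
  represented {a} {c} r with ℤₚ.≤-total (- c) a
  ... | inj₁ -c≤a = let i , eq = canonical-represented r -c≤a in i , inj₁ eq
  ... | inj₂ a≤-c =
    let i , eq = canonical-represented (-‿isRoot r)
                   (subst (ℤ._≤ - c) (sym (ℤₚ.neg-involutive a)) a≤-c)
    in i , inj₂ eq

  -- Two representatives of one root are both canonical only if `a ≡ - c`, and then they coincide.
  -- So no root is listed twice.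
  index-unique : ∀ i j {a c} → Represents i a c → Represents j a c → i ≡ j
  index-unique i j {a} {c} p q = lookup-injective roots unique (same p q)
    where
    unique : Unique (toList roots)
    unique = subst Unique (sym (Vecₚ.toList∘fromList sortedRoots))
      (Unique-resp-↭ (↭-sym (sort-↭ unsortedRoots))
        (Uniqueₚ.filter⁺ canonical?
          (Uniqueₚ.cartesianProduct⁺ (entries-unique n) (entries-unique n))))
    canonical : ∀ i {a c} → lookup roots i ≡ (a , c) → - c ℤ.≤ a
    canonical i refl = proj₁ (proj₂ (proj₂ (root-canonical i)))
    self-opposite : ∀ i j → lookup roots i ≡ (a , c) → lookup roots j ≡ (- c , - a) → a ≡ - c
    self-opposite i j p q = ℤₚ.≤-antisym
      (subst (ℤ._≤ - c) (ℤₚ.neg-involutive a) (canonical j q)) (canonical i p)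
    opposite-eq : a ≡ - c → (a , c) ≡ (- c , - a)
    opposite-eq refl = cong (- c ,_) (sym (ℤₚ.neg-involutive c))
    same : Represents i a c → Represents j a c → lookup roots i ≡ lookup roots j
    same (inj₁ p) (inj₁ q) = trans p (sym q)
    same (inj₂ p) (inj₂ q) = trans p (sym q)
    same (inj₁ p) (inj₂ q) = trans p (trans (opposite-eq (self-opposite i j p q)) (sym q))
    same (inj₂ p) (inj₁ q) = trans p (trans (sym (opposite-eq (self-opposite j i q p))) (sym q))

  height-index : ∀ i {a c} → IsRoot a c → Represents i a c → height (lo i) (hi i) ≡ height a c
  height-index i r             (inj₁ refl) = refl
  height-index i (ea , ec , _) (inj₂ eq)   rewrite eq = height-neg ea ec

  height-mono : ∀ i j → i Fin.≤ j → height (lo i) (hi i) ℤ.≤ height (lo j) (hi j)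
  height-mono i j i≤j with ℕₚ.m≤n⇒m<n∨m≡n i≤j
  ... | inj₂ i≡j rewrite Finₚ.toℕ-injective i≡j = ℤₚ.≤-refl
  ... | inj₁ i<j = AllPairs-lookup roots
    (subst (AllPairs _) (sym (Vecₚ.toList∘fromList sortedRoots))
      (Sorted⇒AllPairs (DecTotalOrder.totalOrder byHeight) (sort-↗ unsortedRoots))) i<j

  -- Initial segments: closedness, modularity and primality.

  Segment : Fin (suc rootCount) → ℤ → ℤ → Set
  Segment k a c = IsRoot a c × ∃ λ i → toℕ i ℕ.< toℕ k × Represents i a c

  -- Distinct roots may have equal heights. Asking only for strictly lower pairs makes every segment
  -- of the sorted list initial, however the ties are placed.
  Initial : (ℤ → ℤ → Set) → Set
  Initial R = ∀ {a b c d} → R a b → IsRoot c d → height c d ℤ.< height a b → R c d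

  Segment-initial : ∀ {k} → Initial (Segment k)
  Segment-initial {k} (r , i , i<k , rep) r′ h<h′ =
    let j , rep′ = represented r′
        j<i = ℕₚ.≰⇒> λ i≤j → ℤₚ.<⇒≱ h<h′
                (subst₂ ℤ._≤_ (height-index i r rep) (height-index j r′ rep′) (height-mono i j i≤j))
    in r′ , j , ℕₚ.<-trans j<i i<k , rep′

  -- Forcing leads to a lower pair, and a composite lies between its factors in height, hence below
  -- one of them. Both closure conditions thus follow from being initial.
  Segment-isClosed : ∀ k → IsClosed (Segment k)
  Segment-isClosed k = record
    { isDown = record
      { dec    = λ a c → isRoot? a c ×-dec Finₚ.any? (λ i → (toℕ i ℕ.<? toℕ k) ×-dec
                   (≡-pair? (lookup roots i) (a , c) ⊎-dec ≡-pair? (lookup roots i) (- c , - a)))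
      ; isRoot = proj₁
      ; symm   = λ (r , i , i<k , rep) → -‿isRoot r , i , i<k , Represents-neg i rep
      ; up-R   = λ s@((ea , ec , _) , _) eb a<b b<c b∈U → Segment-initial {k} s (eb , ec , b<c)
                   (let p , q = height-up ea eb ec a<b b<c b∈U in p) }
    ; R-trans = seg-trans }
    where
    ≡-pair? : (p q : ℤ × ℤ) → Dec (p ≡ q)
    ≡-pair? = Productₚ.≡-dec ℤ._≟_ ℤ._≟_
    Represents-neg : ∀ i {a c} → Represents i a c → Represents i (- c) (- a)
    Represents-neg i (inj₁ eq) = inj₂ (trans eq
      (cong₂ _,_ (sym (ℤₚ.neg-involutive _)) (sym (ℤₚ.neg-involutive _))))
    Represents-neg i (inj₂ eq) = inj₁ eq
    seg-trans : ∀ {a b c} → Segment k a b → Segment k b c → Segment k a c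
    seg-trans {b = b} s@((ea , eb , a<b) , _) t@((_ , ec , b<c) , _) with up b in eq
    ... | true  = Segment-initial {k} s (ea , ec , ℤₚ.<-trans a<b b<c)
                    (proj₂ (height-up ea eb ec a<b b<c eq))
    ... | false = Segment-initial {k} t (ea , ec , ℤₚ.<-trans a<b b<c)
                    (proj₂ (height-down ea eb ec a<b b<c eq))

  -- Follow a path in Y ∪ X from a to c.  While up is false, the pair formed by a and the
  -- current value lies in Z.  When it reaches b with up b by a step of X, initiality puts (a , c)
  -- itself in X; otherwise (b , c) ∈ Z and the argument restarts at b.
  module _ {X Y Z D : ℤ → ℤ → Set}
    (X-initial : Initial X) (X-down : IsDown X) (Y-down : IsDown Y) (Z-down : IsDown Z)
    (D-trans : ∀ {a b c} → D a b → D b c → D a c)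
    (Y⊆D : ∀ {a c} → Y a c → D a c) (X∩Z⊆D : ∀ {a c} → X a c → Z a c → D a c) where

    private
      Y∪X : ℤ → ℤ → Set
      Y∪X a c = Y a c ⊎ X a c

      Y∪X-down : IsDown Y∪X
      Y∪X-down = ∪-isDown Y-down X-down

      module X = IsDown X-down
      module Z = IsDown Z-down

      -- The part of a path from a to b that has already been treated.
      Done : ℤ → ℤ → Set
      Done a b = a ≡ b ⊎ (D a b × up b ≡ false × IsEntry n a × a ℤ.< b)

      -- With `b` in `D` the pair `(a , c)` is lower than `(b , c)`, so a step of `X` can be
      -- extended back to `a`.
      step : ∀ {a b c} → Done a b → Y∪X b c → D a c ⊎ X a c
      step (inj₁ refl) q = Sum.map Y⊆D id q
      step (inj₂ (d , _)) (inj₁ y) = inj₁ (D-trans d (Y⊆D y))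
      step (inj₂ (d , b∈D , ea , a<b)) (inj₂ x) =
        let eb , ec , b<c = X.isRoot x
        in inj₂ (X-initial x (ea , ec , ℤₚ.<-trans a<b b<c)
                   (proj₂ (height-down ea eb ec a<b b<c b∈D)))

      split : ∀ {a b c} → Z a c → Done a b → TransClosure Y∪X b c → D a c
      split z s [ q ] = [ id , (λ x → X∩Z⊆D x z) ]′ (step s q)
      split {a} {b} {c} z s (_∷_ {y = b′} q p)
        with up b′ in eq | step s q | IsDown.isRoot Y∪X-down q | ⁺-isRoot Y∪X-down p | Z.isRoot z
      ... | true | inj₁ d | _ , eb′ , b<b′ | _ , _ , b′<c | ea , _ , _ =
        D-trans d (split (Z.up-R z eb′ (a<b′ s) b′<c eq) (inj₁ refl) p)
        where
        a<b′ : Done a b → a ℤ.< b′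
        a<b′ (inj₁ refl) = b<b′
        a<b′ (inj₂ (_ , _ , _ , a<b)) = ℤₚ.<-trans a<b b<b′
      ... | true | inj₂ x | _ | _ , _ , b′<c | ea , ec , a<c =
        let _ , eb′ , a<b′ = X.isRoot x
        in X∩Z⊆D (X-initial x (ea , ec , a<c) (proj₂ (height-up ea eb′ ec a<b′ b′<c eq))) z
      ... | false | dx | _ , eb′ , b<b′ | _ , _ , b′<c | ea , _ , _ =
        split z (inj₂ ([ id , (λ x → X∩Z⊆D x zab′) ]′ dx , eq , ea , a<b′)) p
        where
        a<b′ : a ℤ.< b′
        a<b′ = [ (λ { refl → b<b′ }) , (λ (_ , _ , _ , a<b) → ℤₚ.<-trans a<b b<b′) ]′ s
        zab′ : Z a b′
        zab′ = Z.down-R z eb′ a<b′ b′<c eq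

    -- For `D` the join of `Y` with `X ∩ Z` this is the inequality `(Y ∨ X) ∧ Z ≤ Y ∨ (X ∧ Z)`, the
    -- substantial half of left modularity of `X`.
    modularity : ∀ {a c} → Z a c → TransClosure Y∪X a c → D a c
    modularity z p = split z (inj₁ refl) p

  module _ {Y Z : ℤ → ℤ → Set} (Y-closed : IsClosed Y) (Z-closed : IsClosed Z) {p q : ℤ}
    (below-Y : ∀ {a c} → IsRoot a c → height a c ℤ.< height p q → Y a c)
    (below-Z : ∀ {a c} → IsRoot a c → height a c ℤ.< height p q → Z a c)
    (pq-isRoot : IsRoot p q) where

    private
      module Y = IsClosed Y-closed
      module Z = IsClosed Z-closed
      ep = proj₁ pq-isRoot
      eq = proj₁ (proj₂ pq-isRoot)

      Y∪Z-down = ∪-isDown Y.isDown Z.isDown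

      Done : ℤ → Set
      Done b = p ≡ b ⊎ (Y p b × Z p b)

      step : ∀ {b c} → Done b → Y b c ⊎ Z b c → Y p c ⊎ Z p c
      step (inj₁ refl)     r = r
      step (inj₂ (y , z)) r = Sum.map (Y.R-trans y) (Z.R-trans z) r

      -- If `b` is in `U`, the last piece `(b , q)` is lower than `(p , q)`; it lies in both
      -- relations and completes whichever contains `(p , b)`. If `b` is in `D`, the first piece
      -- `(p , b)` is the lower one; it lies in both relations, so either may take the next step.
      split : ∀ {b} → Done b → TransClosure (λ a c → Y a c ⊎ Z a c) b q → Y p q ⊎ Z p q
      split s [ r ] = step s r
      split s (_∷_ {y = b} r rs) with step s r | ⁺-isRoot Y∪Z-down rs
      ... | t | eb , _ , b<q with proj₂ (proj₂ ([ Y.isRoot , Z.isRoot ]′ t)) | up b in b≡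
      ... | p<b | true =
        let h = proj₁ (height-up ep eb eq p<b b<q b≡)
        in Sum.map (λ y → Y.R-trans y (below-Y (eb , eq , b<q) h))
                   (λ z → Z.R-trans z (below-Z (eb , eq , b<q) h)) t
      ... | p<b | false =
        let h = proj₁ (height-down ep eb eq p<b b<q b≡)
        in split (inj₂ (below-Y (ep , eb , p<b) h , below-Z (ep , eb , p<b) h)) rs

    -- This makes `M` possible: closed relations that contain all lower pairs but not `(p , q)` are
    -- stable under joins.
    primality : TransClosure (λ a c → Y a c ⊎ Z a c) p q → Y p q ⊎ Z p q
    primality = split (inj₁ refl)

  -- Lattice operations and irreducibles for an order realised by closed relations.

  module Realisation {A : Set} (_≤A_ : A → A → Set) (Rel : A → ℤ → ℤ → Set)
    (Rel-isClosed : ∀ x → IsClosed (Rel x))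
    (≤⇒⊆ : ∀ {x y} → x ≤A y → ∀ {a c} → Rel x a c → Rel y a c)
    (⊆⇒≤ : ∀ {x y} → (∀ {a c} → Rel x a c → Rel y a c) → x ≤A y)
    (realise : ∀ {R} → IsClosed R → A)
    (realise⁺ : ∀ {R} (cl : IsClosed R) {a c} → R a c → Rel (realise cl) a c)
    (realise⁻ : ∀ {R} (cl : IsClosed R) {a c} → Rel (realise cl) a c → R a c)
    where

    open OrderNotions _≤A_ using (IsJoin; IsMeet; LeftModular; IsTrim)
    module Rel x = IsClosed (Rel-isClosed x)

    Rel-∪ : A → A → ℤ → ℤ → Set
    Rel-∪ x y a c = Rel x a c ⊎ Rel y a c

    ∨-isClosed : ∀ x y → IsClosed (TransClosure (Rel-∪ x y))
    ∨-isClosed x y = ⁺-isClosed (∪-isDown (Rel.isDown x) (Rel.isDown y))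

    infixl 6 _∨_
    _∨_ : A → A → A
    x ∨ y = realise (∨-isClosed x y)

    ∧-isClosed : ∀ x y → IsClosed (λ a c → Rel x a c × Rel y a c)
    ∧-isClosed x y = ∩-isClosed (Rel-isClosed x) (Rel-isClosed y)

    _∧_ : A → A → A
    x ∧ y = realise (∧-isClosed x y)

    ∨⁺ˡ : ∀ x y {a c} → Rel x a c → Rel (x ∨ y) a c
    ∨⁺ˡ x y r = realise⁺ (∨-isClosed x y) [ inj₁ r ]

    ∨⁺ʳ : ∀ x y {a c} → Rel y a c → Rel (x ∨ y) a c
    ∨⁺ʳ x y r = realise⁺ (∨-isClosed x y) [ inj₂ r ]

    ∨-least : ∀ x y {u} → (∀ {a c} → Rel x a c → Rel u a c) → (∀ {a c} → Rel y a c → Rel u a c) →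
      ∀ {a c} → Rel (x ∨ y) a c → Rel u a c
    ∨-least x y {u} x⊆u y⊆u = ⁺-least (Rel.R-trans u) [ x⊆u , y⊆u ]′ ∘ realise⁻ (∨-isClosed x y)

    ∨-isJoin : ∀ x y → IsJoin x y (x ∨ y)
    ∨-isJoin x y = ⊆⇒≤ (∨⁺ˡ x y) , ⊆⇒≤ (∨⁺ʳ x y)
      , λ u x≤u y≤u → ⊆⇒≤ (∨-least x y {u} (≤⇒⊆ x≤u) (≤⇒⊆ y≤u))

    ∧-isMeet : ∀ x y → IsMeet x y (x ∧ y)
    ∧-isMeet x y = ⊆⇒≤ (proj₁ ∘ realise⁻ (∧-isClosed x y)) , ⊆⇒≤ (proj₂ ∘ realise⁻ (∧-isClosed x y))
      , λ u u≤x u≤y → ⊆⇒≤ λ r → realise⁺ (∧-isClosed x y) (≤⇒⊆ u≤x r , ≤⇒⊆ u≤y r)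

    seg : Fin (suc rootCount) → A
    seg k = realise (Segment-isClosed k)

    seg-initial : ∀ k → Initial (Rel (seg k))
    seg-initial k r r′ h<h′ = realise⁺ (Segment-isClosed k)
      (Segment-initial {k} (realise⁻ (Segment-isClosed k) r) r′ h<h′)

    mem : A → Fin rootCount → Set
    mem x i = Rel x (lo i) (hi i)

    mem⊆⇒⊆ : ∀ {x y} → (∀ i → mem x i → mem y i) → ∀ {a c} → Rel x a c → Rel y a c
    mem⊆⇒⊆ {x} {y} x⊆y {a} {c} r = go (represented (Rel.isRoot x r))
      where
      transport : ∀ i {p} → lookup roots i ≡ p →
        Rel x (proj₁ p) (proj₂ p) → Rel y (proj₁ p) (proj₂ p)
      transport i refl = x⊆y i
      go : (∃ λ i → Represents i a c) → Rel y a c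
      go (i , inj₁ eq) = transport i eq r
      go (i , inj₂ eq) = Rel.unsymm y (transport i eq (Rel.symm x r))

    mem-seg⁺ : ∀ {k i} → toℕ i ℕ.< toℕ k → mem (seg k) i
    mem-seg⁺ {k} {i} i<k = realise⁺ (Segment-isClosed k) (root-isRoot i , i , i<k , inj₁ refl)

    mem-seg⁻ : ∀ {k i} → mem (seg k) i → toℕ i ℕ.< toℕ k
    mem-seg⁻ {k} {i} r with realise⁻ (Segment-isClosed k) r
    ... | _ , j , j<k , rep rewrite index-unique i j (inj₁ refl) rep = j<k

    generated : ℤ → ℤ → A
    generated a c = realise (Generated-isClosed a c)

    generated-least : ∀ {x a c} → Rel x a c → ∀ {a′ c′} → Rel (generated a c) a′ c′ → Rel x a′ c′
    generated-least {x} {a} {c} r =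
      Generated-least (Rel-isClosed x) r ∘ realise⁻ (Generated-isClosed a c)

    C : Fin rootCount → A
    C k = generated (lo k) (hi k)

    mem-C : ∀ k → mem (C k) k
    mem-C k = realise⁺ (Generated-isClosed (lo k) (hi k)) (Generated-self (root-isRoot k))

    seg-below : ∀ {x} k → (∀ {a c} → Rel (seg (inject₁ k)) a c → Rel x a c) →
      ∀ {a c} → IsRoot a c → height a c ℤ.< height (lo k) (hi k) → Rel x a c
    seg-below k seg⊆x r h< = seg⊆x (realise⁺ (Segment-isClosed (inject₁ k)) (before r h<))
      where
      before : ∀ {a c} → IsRoot a c → height a c ℤ.< height (lo k) (hi k) → Segment (inject₁ k) a c
      before r h< =
        let j , rep = represented r
            j<k = ℕₚ.≰⇒> λ k≤j → ℤₚ.<⇒≱ h<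
                    (subst (height (lo k) (hi k) ℤ.≤_) (height-index j r rep) (height-mono k j k≤j))
        in r , j , subst (toℕ j ℕ.<_) (sym (Finₚ.toℕ-inject₁ k)) j<k , rep

    module _ (k : Fin rootCount) where

      private
        s = seg (inject₁ k)

        mem-least : ∀ {u a c} → Rel u a c → (∀ {a c} → Rel s a c → Rel u a c) →
          mem (generated a c ∨ s) k → mem u k
        mem-least {u} {a} {c} r s⊆u = ∨-least (generated a c) s {u} (generated-least r) s⊆u

        ∨-self : ∀ {a c} → IsRoot a c → Rel (generated a c ∨ s) a c
        ∨-self {a} {c} r =
          ∨⁺ˡ (generated a c) s (realise⁺ (Generated-isClosed a c) (Generated-self r))

        ∨-prime : ∀ y z → (∀ {a c} → Rel s a c → Rel y a c) → (∀ {a c} → Rel s a c → Rel z a c) →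
          mem (y ∨ z) k → mem y k ⊎ mem z k
        ∨-prime y z s⊆y s⊆z r = primality (Rel-isClosed y) (Rel-isClosed z)
          (seg-below {y} k s⊆y) (seg-below {z} k s⊆z) (root-isRoot k) (realise⁻ (∨-isClosed y z) r)

      -- This is the union of all elements above `s` without `k`, in decidable form: it suffices to
      -- test the least element above `s` that contains `(a , c)`.
      Avoiding : ℤ → ℤ → Set
      Avoiding a c = IsRoot a c × ¬ mem (generated a c ∨ s) k

      Avoiding-isClosed : IsClosed Avoiding
      Avoiding-isClosed = record
        { isDown = record
          { dec    = λ a c → isRoot? a c ×-dec ¬? (Rel.dec (generated a c ∨ s) (lo k) (hi k))
          ; isRoot = proj₁
          ; symm   = λ {a} {c} (r , ∌k) → -‿isRoot r , ∌k ∘ mem-least {generated a c ∨ s}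
                       (Rel.symm (generated a c ∨ s) (∨-self r)) (∨⁺ʳ (generated a c) s)
          ; up-R   = λ {a} {b} {c} (r@(_ , ec , _) , ∌k) eb a<b b<c b∈U →
                       (eb , ec , b<c) , ∌k ∘ mem-least {generated a c ∨ s}
                         (Rel.up-R (generated a c ∨ s) (∨-self r) eb a<b b<c b∈U)
                         (∨⁺ʳ (generated a c) s) }
        ; R-trans = avoiding-trans }
        where
        -- The join of `y` and `z` contains `(a , c)` and `s`, so it would contain `k` if `(a , c)`
        -- produced it. By primality `k` would then already be in `y` or in `z`.
        avoiding-trans : ∀ {a b c} → Avoiding a b → Avoiding b c → Avoiding a c
        avoiding-trans {a} {b} {c} (r@(ea , _ , a<b) , y∌k) (r′@(_ , ec , b<c) , z∌k) =
            (ea , ec , ℤₚ.<-trans a<b b<c)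
          , λ ∋k → [ y∌k , z∌k ]′ (∨-prime y z (∨⁺ʳ (generated a b) s) (∨⁺ʳ (generated b c) s)
              (mem-least {y ∨ z}
                (Rel.R-trans (y ∨ z) (∨⁺ˡ y z (∨-self r)) (∨⁺ʳ y z (∨-self r′)))
                (∨⁺ˡ y z ∘ ∨⁺ʳ (generated a b) s) ∋k))
          where
          y = generated a b ∨ s
          z = generated b c ∨ s

      M : A
      M = realise Avoiding-isClosed

      mem-M : ¬ mem M k
      mem-M r = proj₂ (realise⁻ Avoiding-isClosed r) (∨-self (root-isRoot k))

      M-greatest : ∀ {x} → (∀ {a c} → Rel s a c → Rel x a c) → ¬ mem x k →
        ∀ {a c} → Rel x a c → Rel M a c
      M-greatest {x} s⊆x x∌k r =
        realise⁺ Avoiding-isClosed (Rel.isRoot x r , x∌k ∘ mem-least {x} r s⊆x)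

      seg⊆M : ∀ {a c} → Rel s a c → Rel M a c
      seg⊆M = M-greatest {s} id λ r →
        ℕₚ.<-irrefl (sym (Finₚ.toℕ-inject₁ k)) (mem-seg⁻ {inject₁ k} r)

    leftModular : ∀ {x} → Initial (Rel x) → LeftModular x
    leftModular {x} x-initial y z (y≤z , _) a b c d
      (y≤a , x≤a , a-least) (b≤a , b≤z , b-greatest)
      (c≤x , c≤z , c-greatest) (y≤d , c≤d , d-least) =
        ⊆⇒≤ (λ r → modularity x-initial (Rel.isDown x) (Rel.isDown y) (Rel.isDown z)
          (Rel.R-trans d) (≤⇒⊆ y≤d)
          (λ rx rz → ≤⇒⊆ c≤d (≤⇒⊆ x∧z≤c (realise⁺ (∧-isClosed x z) (rx , rz))))
          (≤⇒⊆ b≤z r) (realise⁻ (∨-isClosed y x) (≤⇒⊆ a≤y∨x (≤⇒⊆ b≤a r))))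
      -- This half holds in every lattice, because `y ≤ z`.
      , d-least b (b-greatest y y≤a y≤z)
          (b-greatest c (⊆⇒≤ (≤⇒⊆ x≤a ∘ ≤⇒⊆ c≤x)) c≤z)
      where
      a≤y∨x = a-least (y ∨ x) (proj₁ (∨-isJoin y x)) (proj₁ (proj₂ (∨-isJoin y x)))
      x∧z≤c = c-greatest (x ∧ z) (proj₁ (∧-isMeet x z)) (proj₁ (proj₂ (∧-isMeet x z)))

    isTrim : IsTrim
    isTrim = ClosureSystem.isTrim _≤A_ rootCount mem (λ x i → Rel.dec x (lo i) (hi i))
      (λ x≤y i → ≤⇒⊆ x≤y) (λ {x} {y} x⊆y → ⊆⇒≤ (mem⊆⇒⊆ {x} {y} x⊆y)) seg
      (λ {k} {i} → mem-seg⁺ {k} {i}) (λ {k} {i} → mem-seg⁻ {k} {i})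
      _∨_ _∧_ ∨-isJoin ∧-isMeet (λ {x} {y} rx ry → realise⁺ (∧-isClosed x y) (rx , ry))
      C mem-C (λ {x} k r → ⊆⇒≤ (generated-least {x} r))
      M mem-M (λ k → ⊆⇒≤ (seg⊆M k)) (λ {x} k s≤x x∌k → ⊆⇒≤ (M-greatest k {x} (≤⇒⊆ s≤x) x∌k))
      (λ k → leftModular (seg-initial k))

-- One-line words: positions, symmetry and precedence.

module _ {A : Set} where

  lookup-∷ʳ-fromℕ : ∀ {m} (xs : Vec A m) x → lookup (xs Vec.∷ʳ x) (fromℕ m) ≡ x
  lookup-∷ʳ-fromℕ []       x = refl
  lookup-∷ʳ-fromℕ (_ ∷ xs) x = lookup-∷ʳ-fromℕ xs x

  lookup-∷ʳ-inject₁ : ∀ {m} (xs : Vec A m) x i → lookup (xs Vec.∷ʳ x) (inject₁ i) ≡ lookup xs i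
  lookup-∷ʳ-inject₁ (_ ∷ xs) x Fin.zero    = refl
  lookup-∷ʳ-inject₁ (_ ∷ xs) x (Fin.suc i) = lookup-∷ʳ-inject₁ xs x i

  lookup-reverse : ∀ {m} (xs : Vec A m) i → lookup (Vec.reverse xs) (opposite i) ≡ lookup xs i
  lookup-reverse {suc m} (x ∷ xs) Fin.zero
    rewrite Vecₚ.reverse-∷ x xs = lookup-∷ʳ-fromℕ (Vec.reverse xs) x
  lookup-reverse {suc m} (x ∷ xs) (Fin.suc i)
    rewrite Vecₚ.reverse-∷ x xs =
      trans (lookup-∷ʳ-inject₁ (Vec.reverse xs) x (opposite i)) (lookup-reverse xs i)

opposite-anti : ∀ {m} {p q : Fin m} → p Fin.< q → opposite q Fin.< opposite p
opposite-anti {p = p} {q} p<q =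
  subst₂ ℕ._<_ (sym (Finₚ.opposite-prop q)) (sym (Finₚ.opposite-prop p))
  (ℕₚ.∸-monoʳ-< (s≤s p<q) (Finₚ.toℕ<n q))

module _ {n : ℕ} where

  right : Fin n → Fin (n ℕ.+ n)
  right i = n ↑ʳ i

  -- The left half of a word is the reversed vector of negatives, whence `opposite`: `left i`
  -- carries the negative of the value at `right i`.
  left : Fin n → Fin (n ℕ.+ n)
  left i = opposite i ↑ˡ n

  halves : (p : Fin (n ℕ.+ n)) → (∃ λ i → right i ≡ p) ⊎ (∃ λ i → left i ≡ p)
  halves p with Fin.splitAt n p in eq
  ... | inj₁ j = inj₂ (opposite j
    , trans (cong (_↑ˡ n) (Finₚ.opposite-involutive j)) (Finₚ.splitAt⁻¹-↑ˡ eq))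
  ... | inj₂ i = inj₁ (i , Finₚ.splitAt⁻¹-↑ʳ eq)

  opposite-right : ∀ i → opposite (right i) ≡ left i
  opposite-right i = Finₚ.toℕ-injective (begin
    toℕ (opposite (n ↑ʳ i))           ≡⟨ Finₚ.opposite-prop (n ↑ʳ i) ⟩
    n ℕ.+ n ℕ.∸ suc (toℕ (n ↑ʳ i))    ≡⟨ cong (λ k → n ℕ.+ n ℕ.∸ suc k) (Finₚ.toℕ-↑ʳ n i) ⟩
    n ℕ.+ n ℕ.∸ suc (n ℕ.+ toℕ i)     ≡⟨ cong (n ℕ.+ n ℕ.∸_) (ℕₚ.+-suc n (toℕ i)) ⟨
    n ℕ.+ n ℕ.∸ (n ℕ.+ suc (toℕ i))   ≡⟨ ℕₚ.[m+n]∸[m+o]≡n∸o n n (suc (toℕ i)) ⟩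
    n ℕ.∸ suc (toℕ i)                 ≡⟨ Finₚ.opposite-prop i ⟨
    toℕ (opposite i)                  ≡⟨ Finₚ.toℕ-↑ˡ (opposite i) n ⟨
    toℕ (opposite i ↑ˡ n)             ∎)
    where open ≡.≡-Reasoning

  opposite-left : ∀ i → opposite (left i) ≡ right i
  opposite-left i =
    trans (cong opposite (sym (opposite-right i))) (Finₚ.opposite-involutive (right i))

∣a∣≡∣b∣⇒a≡±b : ∀ a b → ∣ a ∣ ≡ ∣ b ∣ → a ≡ b ⊎ a ≡ - b
∣a∣≡∣b∣⇒a≡±b (+ m)       (+ .m)       refl = inj₁ refl
∣a∣≡∣b∣⇒a≡±b (+ .(suc m)) -[1+ m ]     refl = inj₂ refl
∣a∣≡∣b∣⇒a≡±b -[1+ m ]    (+ .(suc m)) refl = inj₂ refl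
∣a∣≡∣b∣⇒a≡±b -[1+ m ]    -[1+ .m ]    refl = inj₁ refl

entry≢-entry : ∀ {n z} → IsEntry n z → z ≢ - z
entry≢-entry (pos _) ()
entry≢-entry (neg _) ()

∣entry∣ : ∀ {n z} → IsEntry n z → ∣ z ∣ ∈ applyUpTo suc n
∣entry∣ (pos p) = ∈ₚ.∈-applyUpTo⁺ suc p
∣entry∣ (neg p) = ∈ₚ.∈-applyUpTo⁺ suc p

∣entry∣⁻ : ∀ {n} z → ∣ z ∣ ∈ applyUpTo suc n → IsEntry n z
∣entry∣⁻ z ∣z∣∈ with ∈ₚ.∈-applyUpTo⁻ suc ∣z∣∈
∣entry∣⁻ (+ suc i) _ | _ , i<n , refl = pos i<n
∣entry∣⁻ -[1+ i ]  _ | _ , i<n , refl = neg i<n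

module OneLine {n : ℕ} (π : SignedPerm n) where

  private
    v = proj₁ π

  w : Fin (n ℕ.+ n) → ℤ
  w = lookup (word π)

  w-right : ∀ i → w (right i) ≡ lookup v i
  w-right i = Vecₚ.lookup-++ʳ (Vec.reverse (Vec.map -_ v)) v i

  w-left : ∀ i → w (left i) ≡ - lookup v i
  w-left i = trans (Vecₚ.lookup-++ˡ (Vec.reverse (Vec.map -_ v)) v (opposite i))
    (trans (lookup-reverse (Vec.map -_ v) i) (Vecₚ.lookup-map i -_ v))

  w-opposite : ∀ p → w (opposite p) ≡ - w p
  w-opposite p with halves {n} p
  ... | inj₁ (i , refl) = trans (cong w (opposite-right i))
    (trans (w-left i) (cong -_ (sym (w-right i))))
  ... | inj₂ (i , refl) = trans (cong w (opposite-left i))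
    (trans (w-right i) (trans (sym (ℤₚ.neg-involutive _)) (cong -_ (sym (w-left i)))))

  ∣v∣↭ : toList (Vec.map ∣_∣ v) ↭ applyUpTo suc n
  ∣v∣↭ = subst (_↭ applyUpTo suc n) (sym (Vecₚ.toList-map ∣_∣ v)) (proj₂ π)

  v-isEntry : ∀ i → IsEntry n (lookup v i)
  v-isEntry i = ∣entry∣⁻ (lookup v i) (subst (_∈ applyUpTo suc n) (Vecₚ.lookup-map i ∣_∣ v)
    (↭ₚ.∈-resp-↭ ∣v∣↭ (lookup∈toList (Vec.map ∣_∣ v) i)))

  ∣v∣-injective : ∀ {i j} → ∣ lookup v i ∣ ≡ ∣ lookup v j ∣ → i ≡ j
  ∣v∣-injective {i} {j} eq = lookup-injective (Vec.map ∣_∣ v)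
    (Unique-resp-↭ (↭-sym ∣v∣↭)
      (Uniqueₚ.applyUpTo⁺₁ suc n λ i<j _ → ℕₚ.<⇒≢ i<j ∘ ℕₚ.suc-injective))
    (trans (Vecₚ.lookup-map i ∣_∣ v) (trans eq (sym (Vecₚ.lookup-map j ∣_∣ v))))

  v≢-v : ∀ i j → lookup v i ≢ - lookup v j
  v≢-v i j eq with refl ← ∣v∣-injective {i} {j} (trans (cong ∣_∣ eq) (ℤₚ.∣-i∣≡∣i∣ (lookup v j))) =
    entry≢-entry (v-isEntry i) eq

  w-isEntry : ∀ p → IsEntry n (w p)
  w-isEntry p with halves {n} p
  ... | inj₁ (i , refl) = subst (IsEntry n) (sym (w-right i)) (v-isEntry i)
  ... | inj₂ (i , refl) = subst (IsEntry n) (sym (w-left i)) (-‿isEntry (v-isEntry i))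

  w-injective : ∀ {p q} → w p ≡ w q → p ≡ q
  w-injective {p} {q} eq with halves {n} p | halves {n} q
  ... | inj₁ (i , refl) | inj₁ (j , refl) = cong right (∣v∣-injective (cong ∣_∣
    (trans (sym (w-right i)) (trans eq (w-right j)))))
  ... | inj₂ (i , refl) | inj₂ (j , refl) = cong left (∣v∣-injective (cong ∣_∣
    (ℤₚ.neg-injective (trans (sym (w-left i)) (trans eq (w-left j))))))
  ... | inj₁ (i , refl) | inj₂ (j , refl) = ⊥-elim (v≢-v i j
    (trans (sym (w-right i)) (trans eq (w-left j))))
  ... | inj₂ (i , refl) | inj₁ (j , refl) = ⊥-elim (v≢-v j i
    (trans (sym (w-right j)) (trans (sym eq) (w-left i))))

  w-surjective : ∀ {z} → IsEntry n z → ∃ λ p → w p ≡ z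
  w-surjective {z} ez
    with i , eq ← lookup-surjective (Vec.map ∣_∣ v) (↭ₚ.∈-resp-↭ (↭-sym ∣v∣↭) (∣entry∣ ez))
    with ∣a∣≡∣b∣⇒a≡±b z (lookup v i) (trans (sym eq) (Vecₚ.lookup-map i ∣_∣ v))
  ... | inj₁ z≡v  = right i , trans (w-right i) (sym z≡v)
  ... | inj₂ z≡-v = left i , trans (w-left i) (sym z≡-v)

  precedes-isEntry : ∀ {a b} → Precedes π a b → IsEntry n a × IsEntry n b
  precedes-isEntry (p , q , _ , refl , refl) = w-isEntry p , w-isEntry q

  precedes-positions : ∀ {p q} → Precedes π (w p) (w q) → p Fin.< q
  precedes-positions (p′ , q′ , p′<q′ , eqp , eqq) =
    subst₂ Fin._<_ (w-injective eqp) (w-injective eqq) p′<q′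

  precedes-trans : ∀ {a b c} → Precedes π a b → Precedes π b c → Precedes π a c
  precedes-trans (p , q , p<q , refl , refl) (q′ , r , q′<r , eq , refl)
    rewrite w-injective eq = p , r , ℕₚ.<-trans p<q q′<r , refl , refl

  precedes-asym : ∀ {a b} → Precedes π a b → ¬ Precedes π b a
  precedes-asym (p , q , p<q , refl , refl) b<a = ℕₚ.<-asym p<q (precedes-positions b<a)

  precedes-total : ∀ {a b} → IsEntry n a → IsEntry n b → a ≢ b → Precedes π a b ⊎ Precedes π b a
  precedes-total ea eb a≢b with w-surjective ea | w-surjective eb
  ... | p , refl | q , refl with Finₚ.<-cmp p q
  ...   | tri< p<q _ _  = inj₁ (p , q , p<q , refl , refl)
  ...   | tri≈ _ refl _ = contradiction refl a≢b
  ...   | tri> _ _ q<p  = inj₂ (q , p , q<p , refl , refl)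

  precedes-neg : ∀ {a b} → Precedes π a b → Precedes π (- b) (- a)
  precedes-neg (p , q , p<q , refl , refl) =
    opposite q , opposite p , opposite-anti p<q , w-opposite q , w-opposite p

  precedes? : ∀ a b → Dec (Precedes π a b)
  precedes? a b = Finₚ.any? λ p → Finₚ.any? λ q →
    (p Finₚ.<? q) ×-dec (w p ℤ.≟ a) ×-dec (w q ℤ.≟ b)

-- Orientations, and signed permutations as closed relations.

module Oriented {n : ℕ} (G : Orientation n) where

  -- arrow i is the direction of the edge between s_i and s_{i+1}.  The value true at
  -- i = n - 1 is arbitrary: ± n is never the middle value of a pattern.
  arrow : ℕ → Bool
  arrow i with i ℕ.<? pred n
  ... | yes p = G (fromℕ< p)
  ... | no  _ = true

  up : ℤ → Bool
  -- Zero is not an entry; the value is a default.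
  up (+ zero)  = true
  up (+ suc i) = not (arrow i)
  up -[1+ i ]  = arrow i

  up-neg : ∀ {z} → IsEntry n z → up (- z) ≡ not (up z)
  up-neg (pos _) = sym (Boolₚ.not-involutive _)
  up-neg (neg _) = refl

  arrow-toℕ : ∀ k → arrow (toℕ k) ≡ G k
  arrow-toℕ k with toℕ k ℕ.<? pred n
  ... | yes p = cong G (Finₚ.fromℕ<-toℕ k p)
  ... | no ¬p = contradiction (Finₚ.toℕ<n k) ¬p

  InU⇒up : ∀ {z} → InU {n} G z → up z ≡ true
  InU⇒up (k , inj₁ (refl , g)) = cong not (trans (arrow-toℕ k) g)
  InU⇒up (k , inj₂ (refl , g)) = trans (arrow-toℕ k) g

  InD⇒¬up : ∀ {z} → InD {n} G z → up z ≡ false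
  InD⇒¬up (k , inj₁ (refl , g)) = cong not (trans (arrow-toℕ k) g)
  InD⇒¬up (k , inj₂ (refl , g)) = trans (arrow-toℕ k) g

  -- A positive `b` is bounded away from `n` by `c`, a negative one from `- n` by `a`. So a middle
  -- value always has a side in the orientation.
  ∣between∣ : ∀ {a b c} → IsEntry n a → IsEntry n b → IsEntry n c → a ℤ.< b → b ℤ.< c →
    ∃ λ (k : Fin (pred n)) → b ≡ + suc (toℕ k) ⊎ b ≡ -[1+ toℕ k ]
  ∣between∣ _ (pos _) (pos j<n) _ (+<+ (s≤s i<j)) =
    let i<k = ℕₚ.<-≤-trans i<j (ℕₚ.pred-mono-≤ j<n)
    in fromℕ< i<k , inj₁ (cong (+_ ∘ suc) (sym (Finₚ.toℕ-fromℕ< i<k)))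
  ∣between∣ (neg j<n) (neg _) _ (-<- i<j) _ =
    let i<k = ℕₚ.<-≤-trans i<j (ℕₚ.pred-mono-≤ j<n)
    in fromℕ< i<k , inj₂ (cong -[1+_] (sym (Finₚ.toℕ-fromℕ< i<k)))

  up⇒InU : ∀ {a b c} → IsEntry n a → IsEntry n b → IsEntry n c → a ℤ.< b → b ℤ.< c →
    up b ≡ true → InU {n} G b
  up⇒InU ea eb ec a<b b<c b∈U with ∣between∣ ea eb ec a<b b<c
  ... | k , inj₁ refl = k , inj₁ (refl , trans (sym (arrow-toℕ k)) (Boolₚ.not-injective b∈U))
  ... | k , inj₂ refl = k , inj₂ (refl , trans (sym (arrow-toℕ k)) b∈U)

  open Cambrian n up up-neg

  Inversion : SignedPerm n → ℤ → ℤ → Set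
  Inversion π a c = a ℤ.< c × Precedes π c a

  inversion-isRoot : ∀ π {a c} → Inversion π a c → IsRoot a c
  inversion-isRoot π (a<c , c≺a) =
    let ec , ea = OneLine.precedes-isEntry π c≺a in ea , ec , a<c

  inversion-symm : ∀ π {a c} → Inversion π a c → Inversion π (- c) (- a)
  inversion-symm π (a<c , c≺a) = ℤₚ.neg-mono-< a<c , OneLine.precedes-neg π c≺a

  -- A root of the weak order names one of its two pairs: `e_j - e_i` is `(i , j)`, `e_i` is
  -- `(- i , i)`, and `e_j + e_i` with `i < j` is `(- j , i)`. The other pairs are reached by
  -- negating, comparing, and negating back.
  ≤W⇒⊆ : ∀ {π σ : SignedPerm n} → π ≤W σ → ∀ {a c} → Inversion π a c → Inversion σ a c
  ≤W⇒⊆ {π} {σ} π≤σ {a} {c} inv@(a<c , c≺a) with inversion-isRoot π inv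
  ... | pos i<n , pos j<n , +<+ i<j = a<c , π≤σ (e-diff _ _ (s≤s z≤n) i<j j<n) c≺a
  ... | neg i<n , neg j<n , -<- j<i = a<c , OneLine.precedes-neg σ
    (π≤σ (e-diff _ _ (s≤s z≤n) (s≤s j<i) i<n) (OneLine.precedes-neg π c≺a))
  ... | neg {i} i<n , pos {j} j<n , -<+ with ℕₚ.<-cmp i j
  ...   | tri≈ _ refl _ = a<c , π≤σ (e-short _ (s≤s z≤n) i<n) c≺a
  ...   | tri> _ _ j<i = a<c , π≤σ (e-sum _ _ (s≤s z≤n) (s≤s j<i) i<n) c≺a
  ...   | tri< i<j _ _ = a<c , OneLine.precedes-neg σ
    (π≤σ (e-sum _ _ (s≤s z≤n) (s≤s i<j) j<n) (OneLine.precedes-neg π c≺a))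

  ⊆⇒≤W : ∀ {π σ : SignedPerm n} → (∀ {a c} → Inversion π a c → Inversion σ a c) → π ≤W σ
  ⊆⇒≤W π⊆σ (e-diff i j 0<i i<j j≤n) inv = proj₂ (π⊆σ (+<+ i<j , inv))
  ⊆⇒≤W π⊆σ (e-short (suc i) 0<i i≤n) inv = proj₂ (π⊆σ (-<+ , inv))
  ⊆⇒≤W π⊆σ (e-sum (suc i) (suc j) 0<i i<j j≤n) inv = proj₂ (π⊆σ (-<+ , inv))

  inversions-isClosed : ∀ π → ¬ Contains231 G π → IsClosed (Inversion π)
  inversions-isClosed π avoids = record
    { isDown = record
      { dec    = λ a c → (a ℤ.<? c) ×-dec precedes? c a
      ; isRoot = inversion-isRoot π
      ; symm   = inversion-symm π
      ; up-R   = inversion-up }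
    ; R-trans = λ (a<b , b≺a) (b<c , c≺b) → ℤₚ.<-trans a<b b<c , precedes-trans c≺b b≺a }
    where
    open OneLine π
    inversion-up : ∀ {a b c} → Inversion π a c → IsEntry n b → a ℤ.< b → b ℤ.< c → up b ≡ true →
      Inversion π b c
    inversion-up inv@(a<c , c≺a@(q , r , q<r , refl , refl)) eb a<b b<c b∈U
      with precedes-total (w-isEntry q) eb (λ { refl → ℤₚ.<-irrefl refl b<c })
    ... | inj₁ c≺b = b<c , c≺b
    -- Otherwise the word reads `b`, `c`, `a` from left to right: a pattern 231 whose 2 lies in `U`.
    ... | inj₂ b≺c@(p , _ , _ , refl , _) = ⊥-elim (avoids
      (p , q , r , precedes-positions b≺c , q<r , a<b , b<c
      , up⇒InU (w-isEntry r) eb (w-isEntry q) a<b b<c b∈U))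

  -- The word of a closed relation.

  module Sorting {R : ℤ → ℤ → Set} (R-closed : IsClosed R) where

    open IsClosed R-closed

    infix 4 _≺_
    -- The order in which the values are to stand in the word: the usual order of integers, reversed
    -- on the pairs of `R`.
    _≺_ : ℤ → ℤ → Set
    a ≺ b = (a ℤ.< b × ¬ R a b) ⊎ R b a

    _≺?_ : ∀ a b → Dec (a ≺ b)
    a ≺? b = ((a ℤ.<? b) ×-dec ¬? (dec a b)) ⊎-dec dec b a

    R-< : ∀ {a b} → R a b → a ℤ.< b
    R-< r = proj₂ (proj₂ (isRoot r))

    ≺-asym : ∀ {a b} → a ≺ b → ¬ b ≺ a
    ≺-asym (inj₁ (a<b , _))  (inj₁ (b<a , _)) = ℤₚ.<-asym a<b b<a
    ≺-asym (inj₁ (_ , ¬r))   (inj₂ r)         = ¬r r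
    ≺-asym (inj₂ r)          (inj₁ (_ , ¬r))  = ¬r r
    ≺-asym (inj₂ r)          (inj₂ r′)        = ℤₚ.<-asym (R-< r) (R-< r′)

    ≺-irrefl : ∀ {a} → ¬ a ≺ a
    ≺-irrefl a≺a = ≺-asym a≺a a≺a

    ≺-total : ∀ {a b} → a ≢ b → a ≺ b ⊎ b ≺ a
    ≺-total {a} {b} a≢b with ℤₚ.<-cmp a b | dec a b | dec b a
    ... | tri< _ _ _   | yes r | _     = inj₂ (inj₂ r)
    ... | tri< a<b _ _ | no ¬r | _     = inj₁ (inj₁ (a<b , ¬r))
    ... | tri≈ _ a≡b _ | _     | _     = contradiction a≡b a≢b
    ... | tri> _ _ _   | _     | yes r = inj₁ (inj₂ r)
    ... | tri> _ _ b<a | _     | no ¬r = inj₂ (inj₁ (b<a , ¬r))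

    ≺-neg : ∀ {a b} → a ≺ b → - b ≺ - a
    ≺-neg (inj₁ (a<b , ¬r)) = inj₁ (ℤₚ.neg-mono-< a<b , ¬r ∘ unsymm)
    ≺-neg (inj₂ r)          = inj₂ (symm r)

    <∧≺⇒¬R : ∀ {a b} → a ℤ.< b → a ≺ b → ¬ R a b
    <∧≺⇒¬R a<b a≺b r = ≺-asym a≺b (inj₂ r)

    <∧≻⇒R : ∀ {a b} → a ℤ.< b → b ≺ a → R a b
    <∧≻⇒R a<b (inj₁ (b<a , _)) = contradiction b<a (ℤₚ.<-asym a<b)
    <∧≻⇒R a<b (inj₂ r)         = r

    -- With `a` the least value, the cycle gives `R a c`. If `c < b`, transitivity yields `R a b`;
    -- if `b < c`, forcing yields `R b c` or `R a b`. Each contradicts a step of the cycle.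
    acyclic-min : ∀ {a b c} → IsEntry n b → a ℤ.< b → a ℤ.< c → a ≺ b → b ≺ c → ¬ c ≺ a
    acyclic-min {a} {b} {c} eb a<b a<c a≺b b≺c c≺a with ℤₚ.<-cmp b c | up b in eq
    ... | tri≈ _ refl _ | _ = ≺-irrefl b≺c
    ... | tri> _ _ c<b | _ = <∧≺⇒¬R a<b a≺b (R-trans (<∧≻⇒R a<c c≺a) (<∧≻⇒R c<b b≺c))
    ... | tri< b<c _ _ | true  = <∧≺⇒¬R b<c b≺c (up-R (<∧≻⇒R a<c c≺a) eb a<b b<c eq)
    ... | tri< b<c _ _ | false = <∧≺⇒¬R a<b a≺b (down-R (<∧≻⇒R a<c c≺a) eb a<b b<c eq)

    -- The cycle is rotated until its least value comes first.
    acyclic : ∀ {a b c} → IsEntry n a → IsEntry n b → IsEntry n c → a ≺ b → b ≺ c → ¬ c ≺ a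
    acyclic {a} {b} {c} ea eb ec a≺b b≺c c≺a with ℤₚ.<-cmp a b | ℤₚ.<-cmp b c | ℤₚ.<-cmp a c
    ... | tri≈ _ refl _ | _ | _ = ≺-irrefl a≺b
    ... | _ | tri≈ _ refl _ | _ = ≺-irrefl b≺c
    ... | _ | _ | tri≈ _ refl _ = ≺-irrefl c≺a
    ... | tri< a<b _ _ | _ | tri< a<c _ _ = acyclic-min eb a<b a<c a≺b b≺c c≺a
    ... | tri< a<b _ _ | _ | tri> _ _ c<a = acyclic-min ea c<a (ℤₚ.<-trans c<a a<b) c≺a a≺b b≺c
    ... | tri> _ _ b<a | tri< b<c _ _ | _ = acyclic-min ec b<c b<a b≺c c≺a a≺b
    ... | tri> _ _ b<a | tri> _ _ c<b | _ = acyclic-min ea (ℤₚ.<-trans c<b b<a) c<b c≺a a≺b b≺c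

    ≺-trans : ∀ {a b c} → IsEntry n a → IsEntry n b → IsEntry n c → a ≺ b → b ≺ c → a ≺ c
    ≺-trans {a} {b} {c} ea eb ec a≺b b≺c with a ℤ.≟ c
    ... | yes refl = contradiction b≺c (≺-asym a≺b)
    ... | no a≢c = [ id , (λ c≺a → ⊥-elim (acyclic ea eb ec a≺b b≺c c≺a)) ]′ (≺-total a≢c)

    -- The right half of the word takes from each pair of opposite values the one that `≺` puts
    -- last.
    later : Fin n → ℤ
    later i with -[1+ toℕ i ] ≺? (+ suc (toℕ i))
    ... | yes _ = + suc (toℕ i)
    ... | no  _ = -[1+ toℕ i ]

    ∣later∣ : ∀ i → ∣ later i ∣ ≡ suc (toℕ i)
    ∣later∣ i with -[1+ toℕ i ] ≺? (+ suc (toℕ i))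
    ... | yes _ = refl
    ... | no  _ = refl

    later-isEntry : ∀ i → IsEntry n (later i)
    later-isEntry i with -[1+ toℕ i ] ≺? (+ suc (toℕ i))
    ... | yes _ = pos (Finₚ.toℕ<n i)
    ... | no  _ = neg (Finₚ.toℕ<n i)

    -later≺later : ∀ i → - later i ≺ later i
    -later≺later i with -[1+ toℕ i ] ≺? (+ suc (toℕ i))
    ... | yes p = p
    ... | no ¬p = [ id , (λ p → contradiction p ¬p) ]′ (≺-total λ ())

    later-injective : ∀ {i j} → later i ≡ later j → i ≡ j
    later-injective {i} {j} eq = Finₚ.toℕ-injective (ℕₚ.suc-injective
      (trans (sym (∣later∣ i)) (trans (cong ∣_∣ eq) (∣later∣ j))))

    later-order : DecTotalOrder _ _ _
    later-order = record
      { Carrier = Fin n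
      ; _≈_ = _≡_
      ; _≤_ = λ i j → i ≡ j ⊎ later i ≺ later j
      ; isDecTotalOrder = record
        { isTotalOrder = record
          { isPartialOrder = record
            { isPreorder = record
              { isEquivalence = ≡.isEquivalence
              ; reflexive = inj₁
              ; trans = λ { (inj₁ refl) q → q ; p (inj₁ refl) → p
                          ; (inj₂ p) (inj₂ q) → inj₂ (≺-trans (later-isEntry _) (later-isEntry _)
                                                        (later-isEntry _) p q) } }
            ; antisym = λ { (inj₁ eq) _ → eq ; _ (inj₁ eq) → sym eq
                          ; (inj₂ p) (inj₂ q) → contradiction q (≺-asym p) } }
          ; total = λ i j → compare i j (i Finₚ.≟ j) }
        ; _≟_ = Finₚ._≟_
        ; _≤?_ = λ i j → (i Finₚ.≟ j) ⊎-dec (later i ≺? later j) } }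
      where
      compare : ∀ i j → Dec (i ≡ j) → (i ≡ j ⊎ later i ≺ later j) ⊎ (j ≡ i ⊎ later j ≺ later i)
      compare i j (yes eq) = inj₁ (inj₁ eq)
      compare i j (no i≢j) = Sum.map inj₂ inj₂ (≺-total (i≢j ∘ later-injective))

    open Sort later-order using (sort; sort-↭; sort-↗)

    order : List (Fin n)
    order = sort (List.allFin n)

    orderVec : Σ (Vec (Fin n) n) λ o → toList o ≡ order
    orderVec = fromList′ order
      (trans (↭ₚ.↭-length (sort-↭ (List.allFin n))) (Listₚ.length-tabulate id))
      where
      fromList′ : ∀ {m} (xs : List (Fin n)) → length xs ≡ m → Σ (Vec (Fin n) m) λ o → toList o ≡ xs
      fromList′ xs refl = Vec.fromList xs , Vecₚ.toList∘fromList xs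

    o : Vec (Fin n) n
    o = proj₁ orderVec

    tabulate-∘toℕ : ∀ m (f : ℕ → ℕ) → List.tabulate {n = m} (f ∘ toℕ) ≡ applyUpTo f m
    tabulate-∘toℕ zero    f = refl
    tabulate-∘toℕ (suc m) f = cong (f 0 ∷_) (tabulate-∘toℕ m (f ∘ suc))

    perm : SignedPerm n
    perm = Vec.map later o , (begin
      List.map ∣_∣ (toList (Vec.map later o))
        ≡⟨ cong (List.map ∣_∣) (Vecₚ.toList-map later o) ⟩
      List.map ∣_∣ (List.map later (toList o))     ≡⟨ Listₚ.map-∘ (toList o) ⟨
      List.map (∣_∣ ∘ later) (toList o)            ≡⟨ Listₚ.map-cong ∣later∣ (toList o) ⟩
      List.map (suc ∘ toℕ) (toList o)              ≡⟨ cong (List.map (suc ∘ toℕ)) (proj₂ orderVec) ⟩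
      List.map (suc ∘ toℕ) order                   ↭⟨ ↭ₚ.map⁺ (suc ∘ toℕ) (sort-↭ (List.allFin n)) ⟩
      List.map (suc ∘ toℕ) (List.allFin n)         ≡⟨ Listₚ.map-tabulate id (suc ∘ toℕ) ⟩
      List.tabulate (suc ∘ toℕ)                    ≡⟨ tabulate-∘toℕ n suc ⟩
      applyUpTo suc n                              ∎)
      where open PermutationReasoning

    open OneLine perm

    o-sorted : ∀ {i j} → i Fin.< j → later (lookup o i) ≺ later (lookup o j)
    o-sorted i<j = [ (λ eq → contradiction eq (AllPairs-lookup o unique i<j)) , id ]′
      (AllPairs-lookup o sorted i<j)
      where
      unique : Unique (toList o)
      unique = subst Unique (sym (proj₂ orderVec))
        (Unique-resp-↭ (↭-sym (sort-↭ (List.allFin n))) (Uniqueₚ.allFin⁺ n))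
      sorted = subst (AllPairs _) (sym (proj₂ orderVec))
        (Sorted⇒AllPairs (DecTotalOrder.totalOrder later-order) (sort-↗ (List.allFin n)))

    w-right′ : ∀ i → w (right i) ≡ later (lookup o i)
    w-right′ i = trans (w-right i) (Vecₚ.lookup-map i later o)

    w-left′ : ∀ i → w (left i) ≡ - later (lookup o i)
    w-left′ i = trans (w-left i) (cong -_ (Vecₚ.lookup-map i later o))

    -- If `later j` came before `- later i`, negation would put `later i` before `- later j`, hence
    -- before `later j`, and `later j`, `- later i`, `later i` would form a cycle. Equality of the
    -- two values would reverse `- later i ≺ later i`.
    -later≺ : ∀ i j → - later i ≺ later j
    -later≺ i j with - later i ℤ.≟ later j
    ... | yes eq = contradiction (-later≺later i) (≺-asym
      (subst₂ _≺_ (trans (cong -_ (sym eq)) (ℤₚ.neg-involutive _)) (sym eq) (-later≺later j)))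
    ... | no ≢ = [ id , (λ j≺-i → ⊥-elim (acyclic (later-isEntry j) (-‿isEntry (later-isEntry i))
                        (later-isEntry i) j≺-i (-later≺later i) (i≺j j≺-i))) ]′ (≺-total ≢)
      where
      i≺j : later j ≺ - later i → later i ≺ later j
      i≺j j≺-i = ≺-trans (later-isEntry i) (-‿isEntry (later-isEntry j)) (later-isEntry j)
        (subst (_≺ - later j) (ℤₚ.neg-involutive _) (≺-neg j≺-i)) (-later≺later j)

    w-sorted : ∀ {p q} → p Fin.< q → w p ≺ w q
    w-sorted {p} {q} p<q with halves {n} p | halves {n} q
    ... | inj₁ (i , refl) | inj₁ (j , refl) = subst₂ _≺_ (sym (w-right′ i)) (sym (w-right′ j))
      (o-sorted (ℕₚ.+-cancelˡ-< n _ _ (subst₂ ℕ._<_ (Finₚ.toℕ-↑ʳ n i) (Finₚ.toℕ-↑ʳ n j) p<q)))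
    ... | inj₂ (i , refl) | inj₂ (j , refl) = subst₂ _≺_ (sym (w-left′ i)) (sym (w-left′ j))
      (≺-neg (o-sorted (subst₂ Fin._<_ (Finₚ.opposite-involutive j) (Finₚ.opposite-involutive i)
        (opposite-anti
          (subst₂ ℕ._<_ (Finₚ.toℕ-↑ˡ (opposite i) n) (Finₚ.toℕ-↑ˡ (opposite j) n) p<q)))))
    ... | inj₂ (i , refl) | inj₁ (j , refl) = subst₂ _≺_ (sym (w-left′ i)) (sym (w-right′ j))
      (-later≺ (lookup o i) (lookup o j))
    ... | inj₁ (i , refl) | inj₂ (j , refl) = ⊥-elim (ℕₚ.<⇒≱ p<q (ℕₚ.≤-trans
      (ℕₚ.<⇒≤ (subst (ℕ._< n) (sym (Finₚ.toℕ-↑ˡ (opposite j) n)) (Finₚ.toℕ<n (opposite j))))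
      (subst (n ℕ.≤_) (sym (Finₚ.toℕ-↑ʳ n i)) (ℕₚ.m≤m+n n (toℕ i)))))

    inversion⁻ : ∀ {a c} → Inversion perm a c → R a c
    inversion⁻ (a<c , p , q , p<q , refl , refl) = <∧≻⇒R a<c (w-sorted p<q)

    inversion⁺ : ∀ {a c} → R a c → Inversion perm a c
    inversion⁺ {a} {c} r = let ea , ec , a<c = isRoot r in
      a<c , [ (λ a≺c → contradiction (inj₂ r) (≺-asym (sorted a≺c))) , id ]′
              (precedes-total ea ec λ { refl → ℤₚ.<-irrefl refl a<c })
      where
      sorted : ∀ {a c} → Precedes perm a c → a ≺ c
      sorted (p , q , p<q , refl , refl) = w-sorted p<q

    avoids231 : ¬ Contains231 G perm
    avoids231 (p , q , r , p<q , q<r , wr<wp , wp<wq , p∈U) = precedes-asym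
      (p , q , p<q , refl , refl) q≺p
      where
      -- The inverted values 3 and 1 of the pattern force 3 to precede 2, because 2 lies in `U`.
      q≺p = proj₂ (inversion⁺ (up-R
              (inversion⁻ (ℤₚ.<-trans wr<wp wp<wq , q , r , q<r , refl , refl))
              (w-isEntry p) wr<wp wp<wq (InU⇒up p∈U)))

    avoids312 : ¬ Contains312 G perm
    avoids312 (p , q , r , p<q , q<r , wq<wr , wr<wp , r∈D) = precedes-asym
      r≺q (q , r , q<r , refl , refl)
      where
      -- The inverted values 3 and 1 force 2 to precede 1, because 2 lies in `D`.
      r≺q = proj₂ (inversion⁺ (down-R
              (inversion⁻ (ℤₚ.<-trans wq<wr wr<wp , p , q , p<q , refl , refl))
              (w-isEntry r) wq<wr wr<wp (InD⇒¬up r∈D)))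

    cambrian : CambrianB n G
    cambrian = perm , avoids231 , avoids312

theorem8 : (n : ℕ) → 2 ≤ n → (G : Orientation n) →
    OrderNotions.IsTrim (_≤B_ {n} {G})
theorem8 n _ G = Realisation.isTrim (_≤B_ {n} {G})
  (λ x → Inversion (proj₁ x)) (λ x → inversions-isClosed (proj₁ x) (proj₁ (proj₂ x)))
  (λ {x} {y} → ≤W⇒⊆ {proj₁ x} {proj₁ y}) (λ {x} {y} → ⊆⇒≤W {proj₁ x} {proj₁ y})
  Sorting.cambrian Sorting.inversion⁺ Sorting.inversion⁻
  where
  open Oriented {n} G
  open Cambrian n up up-neg
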